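{- Let $0<\beta<1$ and let $f\colon \mathbb{R}_{>0}\to\mathbb{R}_{\ge 0}$ be a non-decreasing function. Let $\mathcal{G}$ be a hereditary graph class such that, for every $n$-vertex graph $G\in\mathcal{G}$, there exists a $\beta$-balanced clique-based separator of $G$ of size $\mathcal{O}(f(n))$. Then every $n$-vertex graph $G\in\mathcal{G}$ has tree-independence number $\mathcal{O}(f(n)\cdot\log n)$. If in addition $f(n)=\Omega(n^{\varepsilon})$ for some $\varepsilon>0$ and there exists $c<1$ such that $f(\lfloor \beta n\rfloor)\le c f(n)$ for all sufficiently large $n$, then every $n$-vertex graph $G\in\mathcal{G}$ has tree-independence number $\mathcal{O}(f(n))$.
   Context: All graphs are finite, simple and have at least one vertex. A graph class is hereditary if it is closed under vertex deletion. A separation of a graph $G$ is a pair $(A,B)$ of subsets of $V(G)$ with $A\cup B=V(G)$ and no edge between $A\setminus B$ and $B\setminus A$; it is $\beta$-balanced if $\max\{|A\setminus B|,|B\setminus A|\}\le\beta|V(G)|$. Its separator is $A\cap B$. A $\beta$-balanced clique-based separator of $G$ is a collection $\mathcal{S}$ of pairwise vertex-disjoint cliques of $G$ whose union is the separator of a $\beta$-balanced separation of $G$; its size is $|\mathcal{S}|$. A tree decomposition of $G$ is a pair $(T,\{X_t\}_{t\in V(T)})$ with $T$ a tree and bags $X_t\subseteq V(G)$ such that every vertex of $G$ is in some bag, both endpoints of every edge lie in a common bag, and for each $u\in V(G)$ the nodes $t$ with $u\in X_t$ induce a connected subgraph of $T$. Its independence number is $\max_t\alpha(G[X_t])$, where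 $\alpha$ denotes the independence number of a graph. The tree-independence number of $G$ is the minimum independence number of a tree decomposition of $G$. Implicit constants in $\mathcal{O}(\cdot)$ are uniform over all graphs in the class: the hypothesis means there is a constant $C$ such that every graph in $\mathcal{G}$ with $n\ge 1$ vertices has such a separator of size at most $C f(n)$; the conclusions mean there is a constant $C'$ (independent of $G$ and $n$) such that the bound $C' f(n)\log n$, respectively $C' f(n)$, holds for all $G\in\mathcal{G}$ with $n\ge 2$ vertices. -}

module Defs where

open import Data.Nat.Base as ℕ using (ℕ; zero; suc; NonZero)
import Data.Nat.Properties as ℕ
open import Data.Integer.Base as ℤ using (+_; -[1+_])
import Data.Integer.Properties as ℤ
open import Data.Rational.Base as ℚ using (ℚ; mkℚ; 0ℚ; 1ℚ)
import Data.Rational.Properties as ℚ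
import Data.Rational.Unnormalised.Base as ℚᵘ
import Data.Rational.Unnormalised.Properties as ℚᵘ
import Data.Empty as Empty
open import Data.Fin.Base as Fin using (Fin; punchIn)
open import Data.Fin.Subset using (Subset; _∈_; _⊆_; _∩_; _∪_; _─_; ⋃; ∣_∣; ⊤; ⊥; Empty)
open import Data.Fin.Subset.Properties using (∣p∣≤n; ∉⊥; ∈⊤)
open import Data.List.Base using (List; []; _∷_; _++_; length)
open import Data.List.Relation.Unary.All using (All)
open import Data.List.Relation.Unary.AllPairs using (AllPairs)
open import Data.List.Relation.Unary.Linked using (Linked; _∷_)
open import Data.List.Relation.Unary.Unique.Propositional using (Unique)
open import Data.Product.Base using (∃; ∃₂; _×_; _,_; proj₁; proj₂)
open import Data.Sum.Base using (inj₁; inj₂)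
open import Function.Base using (_on_)
open import Level using (0ℓ; Level) renaming (suc to lsuc)
open import Relation.Binary.Core using (Rel)
open import Relation.Binary.Definitions using (Decidable; Symmetric; Irreflexive)
open import Relation.Binary.Construct.Closure.ReflexiveTransitive using (Star; ε)
open import Relation.Binary.PropositionalEquality
open import Relation.Nullary.Negation.Core using (¬_; contradiction)
open import Relation.Nullary.Decidable.Core using (no; decidable-stable)

-- A real x is the Dedekind left cut { q ∈ ℚ ∣ q < x }.  Read classically
-- this is the usual definition: `stable` always holds and the double
-- negation in `rounded` is vacuous.  Constructively the cuts are kept
-- ¬¬-stable, so that the order _≤_ and the formation of suprema behave
-- as they do classically.

record ℝ : Set₁ where
  field
    Below     : ℚ → Set
    stable    : ∀ {q} → ¬ ¬ Below q → Below q
    inhabited : ∃ Below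
    bounded   : ∃ λ q → ¬ Below q
    downward  : ∀ {p q} → p ℚ.≤ q → Below q → Below p
    rounded   : ∀ {p} → Below p → ¬ ¬ (∃ λ q → p ℚ.< q × Below q)

open ℝ public using (Below)

infix 4 _≤_ _<_

_≤_ : ℝ → ℝ → Set
x ≤ y = ∀ {q} → Below x q → Below y q

-- Some rational q satisfies x ≤ q < y.
_<_ : ℝ → ℝ → Set
x < y = ∃ λ q → ¬ Below x q × Below y q

fromℚ : ℚ → ℝ
fromℚ q = record
  { Below     = ℚ._< q
  ; stable    = λ {p} → decidable-stable (p ℚ.<? q)
  ; inhabited = q ℚ.- 1ℚ , q-1<q
  ; bounded   = q , ℚ.<-irrefl refl
  ; downward  = ℚ.≤-<-trans
  ; rounded   = λ p<q ¬∃ → ¬∃ (ℚ.<-dense p<q)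
  }
  where
  q-1<q : q ℚ.- 1ℚ ℚ.< q
  q-1<q = subst (q ℚ.- 1ℚ ℚ.<_) (ℚ.+-identityʳ q)
            (ℚ.+-monoʳ-< q (ℚ.negative⁻¹ (ℚ.- 1ℚ)))

fromℕ : ℕ → ℝ
fromℕ n = fromℚ (+ n ℚ./ 1)

0ℝ 1ℝ : ℝ
0ℝ = fromℕ 0
1ℝ = fromℕ 1

sup : (P : ℚ → Set) → ∃ P → (∃ λ b → ∀ q → P q → q ℚ.≤ b) → ℝ
sup P (p , Pp) (b , ≤b) = record
  { Below     = λ r → ¬ ¬ (∃ λ q → P q × r ℚ.< q)
  ; stable    = λ ¬¬B ¬∃ → ¬¬B (λ B → B ¬∃)
  ; inhabited = let r , r<p = ℝ.inhabited (fromℚ p)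
                in r , λ ¬∃ → ¬∃ (p , Pp , r<p)
  ; bounded   = b , λ B → B λ (q , Pq , b<q) → ℚ.<-irrefl refl (ℚ.<-≤-trans b<q (≤b q Pq))
  ; downward  = λ r≤s B ¬∃ → B λ (q , Pq , s<q) → ¬∃ (q , Pq , ℚ.≤-<-trans r≤s s<q)
  ; rounded   = λ B ¬∃ → B λ (q , Pq , r<q) →
                  let s , r<s , s<q = ℚ.<-dense r<q
                  in ¬∃ (s , r<s , λ ¬B → ¬B (q , Pq , s<q))
  }

-- a < x ≤ b
_∈⟨_,_] : ℝ → ℚ → ℚ → Set
x ∈⟨ a , b ] = Below x a × ¬ Below x b

-- s is a lower bound of the product of the intervals [a,b] and [c,d].
LowerProd : (a b c d s : ℚ) → Set
LowerProd a b c d s =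
  s ℚ.≤ a ℚ.* c × s ℚ.≤ a ℚ.* d × s ℚ.≤ b ℚ.* c × s ℚ.≤ b ℚ.* d

private
  between : ∀ x {a b a′ b′} → x ∈⟨ a , b ] → x ∈⟨ a′ , b′ ] →
            ∃ λ t → (a ℚ.≤ t × t ℚ.≤ b) × (a′ ℚ.≤ t × t ℚ.≤ b′)
  between x {a} {b} {a′} {b′} (xa , xb) (xa′ , xb′) =
    a ℚ.⊔ a′ , (ℚ.p≤p⊔q a a′ , ℚ.⊔-lub (ord xa xb) (ord xa′ xb))
             , (ℚ.p≤q⊔p a a′ , ℚ.⊔-lub (ord xa xb′) (ord xa′ xb′))
    where
    ord : ∀ {p q} → Below x p → ¬ Below x q → p ℚ.≤ q
    ord xp ¬xq = ℚ.≮⇒≥ λ q<p → ¬xq (ℝ.downward x (ℚ.<⇒≤ q<p) xp)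

  lower₁ : ∀ {a b t s} k → a ℚ.≤ t × t ℚ.≤ b →
           s ℚ.≤ a ℚ.* k → s ℚ.≤ b ℚ.* k → s ℚ.≤ t ℚ.* k
  lower₁ k (a≤t , t≤b) s≤ak s≤bk with ℚ.≤-total 0ℚ k
  ... | inj₁ 0≤k = ℚ.≤-trans s≤ak (ℚ.*-monoʳ-≤-nonNeg k {{ℚ.nonNegative 0≤k}} a≤t)
  ... | inj₂ k≤0 = ℚ.≤-trans s≤bk (ℚ.*-monoʳ-≤-nonPos k {{ℚ.nonPositive k≤0}} t≤b)

  upper₁ : ∀ {a b t s} k → a ℚ.≤ t × t ℚ.≤ b →
           a ℚ.* k ℚ.≤ s → b ℚ.* k ℚ.≤ s → t ℚ.* k ℚ.≤ s
  upper₁ k (a≤t , t≤b) ak≤s bk≤s with ℚ.≤-total 0ℚ k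
  ... | inj₁ 0≤k = ℚ.≤-trans (ℚ.*-monoʳ-≤-nonNeg k {{ℚ.nonNegative 0≤k}} t≤b) bk≤s
  ... | inj₂ k≤0 = ℚ.≤-trans (ℚ.*-monoʳ-≤-nonPos k {{ℚ.nonPositive k≤0}} a≤t) ak≤s

  lower₂ : ∀ {a b c d s t u} → LowerProd a b c d s →
           a ℚ.≤ t × t ℚ.≤ b → c ℚ.≤ u × u ℚ.≤ d → s ℚ.≤ t ℚ.* u
  lower₂ {c = c} {d} {s} {t} {u} (ac , ad , bc , bd) t∈ u∈ =
    subst (s ℚ.≤_) (ℚ.*-comm u t)
      (lower₁ t u∈ (subst (s ℚ.≤_) (ℚ.*-comm t c) (lower₁ c t∈ ac bc))
                   (subst (s ℚ.≤_) (ℚ.*-comm t d) (lower₁ d t∈ ad bd)))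

  upper₂ : ∀ {a b c d M t u} →
           (a ℚ.* c ℚ.≤ M × a ℚ.* d ℚ.≤ M × b ℚ.* c ℚ.≤ M × b ℚ.* d ℚ.≤ M) →
           a ℚ.≤ t × t ℚ.≤ b → c ℚ.≤ u × u ℚ.≤ d → t ℚ.* u ℚ.≤ M
  upper₂ {c = c} {d} {M} {t} {u} (ac , ad , bc , bd) t∈ u∈ =
    subst (ℚ._≤ M) (ℚ.*-comm u t)
      (upper₁ t u∈ (subst (ℚ._≤ M) (ℚ.*-comm t c) (upper₁ c t∈ ac bc))
                   (subst (ℚ._≤ M) (ℚ.*-comm t d) (upper₁ d t∈ ad bd)))

-- Interval multiplication, valid for factors of any sign.
infixl 7 _·_

_·_ : ℝ → ℝ → ℝ
x · y = sup P nonempty ub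
  where
  P : ℚ → Set
  P s = ∃₂ λ a b → ∃₂ λ c d → x ∈⟨ a , b ] × y ∈⟨ c , d ] × LowerProd a b c d s

  a₀ = proj₁ (ℝ.inhabited x)
  b₀ = proj₁ (ℝ.bounded x)
  c₀ = proj₁ (ℝ.inhabited y)
  d₀ = proj₁ (ℝ.bounded y)
  x∈ = proj₂ (ℝ.inhabited x) , proj₂ (ℝ.bounded x)
  y∈ = proj₂ (ℝ.inhabited y) , proj₂ (ℝ.bounded y)

  ac = a₀ ℚ.* c₀
  ad = a₀ ℚ.* d₀
  bc = b₀ ℚ.* c₀
  bd = b₀ ℚ.* d₀

  nonempty : ∃ P
  nonempty = (ac ℚ.⊓ ad) ℚ.⊓ (bc ℚ.⊓ bd) , a₀ , b₀ , c₀ , d₀ , x∈ , y∈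
    , ℚ.≤-trans (ℚ.p⊓q≤p (ac ℚ.⊓ ad) _) (ℚ.p⊓q≤p ac ad)
    , ℚ.≤-trans (ℚ.p⊓q≤p (ac ℚ.⊓ ad) _) (ℚ.p⊓q≤q ac ad)
    , ℚ.≤-trans (ℚ.p⊓q≤q (ac ℚ.⊓ ad) _) (ℚ.p⊓q≤p bc bd)
    , ℚ.≤-trans (ℚ.p⊓q≤q (ac ℚ.⊓ ad) _) (ℚ.p⊓q≤q bc bd)

  M = (ac ℚ.⊔ ad) ℚ.⊔ (bc ℚ.⊔ bd)

  ≤M : ac ℚ.≤ M × ad ℚ.≤ M × bc ℚ.≤ M × bd ℚ.≤ M
  ≤M = ℚ.≤-trans (ℚ.p≤p⊔q ac ad) (ℚ.p≤p⊔q (ac ℚ.⊔ ad) _)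
     , ℚ.≤-trans (ℚ.p≤q⊔p ac ad) (ℚ.p≤p⊔q (ac ℚ.⊔ ad) _)
     , ℚ.≤-trans (ℚ.p≤p⊔q bc bd) (ℚ.p≤q⊔p (ac ℚ.⊔ ad) _)
     , ℚ.≤-trans (ℚ.p≤q⊔p bc bd) (ℚ.p≤q⊔p (ac ℚ.⊔ ad) _)

  ub : ∃ λ b → ∀ q → P q → q ℚ.≤ b
  ub = M , λ { q (a , b , c , d , x∈′ , y∈′ , low) →
    let t , t∈ , t∈₀ = between x x∈′ x∈
        u , u∈ , u∈₀ = between y y∈′ y∈
    in ℚ.≤-trans (lower₂ low t∈ u∈) (upper₂ ≤M t∈₀ u∈₀) }

private
  frac-≤ : ∀ p m d → p ℕ.≤ m ℕ.* suc d → + p ℚ./ suc d ℚ.≤ + m ℚ./ 1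
  frac-≤ p m d p≤md = ℚ.toℚᵘ-cancel-≤
    (ℚᵘ.≤-respˡ-≃ (ℚᵘ.≃-sym (ℚ.toℚᵘ-fromℚᵘ (ℚᵘ.mkℚᵘ (+ p) d)))
    (ℚᵘ.≤-respʳ-≃ (ℚᵘ.≃-sym (ℚ.toℚᵘ-fromℚᵘ (ℚᵘ.mkℚᵘ (+ m) 0)))
    (ℚᵘ.*≤* (subst₂ ℤ._≤_ (sym (ℤ.*-identityʳ (+ p))) (ℤ.pos-* m (suc d))
              (ℤ.+≤+ p≤md)))))

  frac-≤⁻¹ : ∀ p m d → + p ℚ./ suc d ℚ.≤ + m ℚ./ 1 → p ℕ.≤ m ℕ.* suc d
  frac-≤⁻¹ p m d le
    with ℚᵘ.≤-respˡ-≃ (ℚ.toℚᵘ-fromℚᵘ (ℚᵘ.mkℚᵘ (+ p) d))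
        (ℚᵘ.≤-respʳ-≃ (ℚ.toℚᵘ-fromℚᵘ (ℚᵘ.mkℚᵘ (+ m) 0)) (ℚ.toℚᵘ-mono-≤ le))
  ... | ℚᵘ.*≤* le′ = ℤ.drop‿+≤+
          (subst₂ ℤ._≤_ (ℤ.*-identityʳ (+ p)) (sym (ℤ.pos-* m (suc d))) le′)

  ceil : (q : ℚ) → ∃ λ m → q ℚ.≤ + m ℚ./ 1
  ceil q@(mkℚ (+ k) d _) = k , subst (ℚ._≤ + k ℚ./ 1) (ℚ.↥p/↧p≡p q)
                                 (frac-≤ k k d (ℕ.m≤m*n k (suc d)))
  ceil q@(mkℚ -[1+ k ] d _) = 0 , ℚ.<⇒≤ (ℚ.negative⁻¹ q)

  n≤2^n : ∀ n → n ℕ.≤ 2 ℕ.^ n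
  n≤2^n zero    = ℕ.z≤n
  n≤2^n (suc n) = ℕ.+-mono-≤ (ℕ.m^n>0 2 n) (ℕ.≤-trans (n≤2^n n) (ℕ.m≤m+n _ 0))

  ^-cancelʳ-≤ : ∀ {p q} → 2 ℕ.^ p ℕ.≤ 2 ℕ.^ q → p ℕ.≤ q
  ^-cancelʳ-≤ le = ℕ.≮⇒≥ λ q<p → ℕ.<⇒≱ (ℕ.^-monoʳ-< 2 (ℕ.s≤s (ℕ.s≤s ℕ.z≤n)) q<p) le

  ^-cancelˡ-≤ : ∀ {a b} d → a ℕ.^ suc d ℕ.≤ b ℕ.^ suc d → a ℕ.≤ b
  ^-cancelˡ-≤ d le = ℕ.≮⇒≥ λ b<a → ℕ.<⇒≱ (ℕ.^-monoˡ-< (suc d) b<a) le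

  ^-distribʳ-* : ∀ d a b → (a ℕ.* b) ℕ.^ d ≡ a ℕ.^ d ℕ.* b ℕ.^ d
  ^-distribʳ-* zero    a b = refl
  ^-distribʳ-* (suc d) a b =
    trans (cong (a ℕ.* b ℕ.*_) (^-distribʳ-* d a b))
          (ℕ.[m*n]*[o*p]≡[m*o]*[n*p] a b (a ℕ.^ d) (b ℕ.^ d))

-- log₂ n = sup { p/d ∣ 2^p ≤ n^d }.  Inside O(·) the base is immaterial.
log₂ : (n : ℕ) → .{{NonZero n}} → ℝ
log₂ n = sup P (0ℚ , 0 , 0 , refl , ℕ.m^n>0 n 1) ub
  where
  P : ℚ → Set
  P q = ∃₂ λ p d → q ≡ + p ℚ./ suc d × 2 ℕ.^ p ℕ.≤ n ℕ.^ suc d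

  ub : ∃ λ b → ∀ q → P q → q ℚ.≤ b
  ub = + n ℚ./ 1 , λ { _ (p , d , refl , 2^p≤n^d) → frac-≤ p n d (^-cancelʳ-≤
    (ℕ.≤-trans 2^p≤n^d
    (ℕ.≤-trans (ℕ.^-monoˡ-≤ (suc d) (n≤2^n n))
               (ℕ.≤-reflexive (ℕ.^-*-assoc 2 n (suc d)))))) }

-- For an integer n ≥ 1 and a real e > 0,
--   n^e = sup { n^(p/d) ∣ p/d < e } = sup { a/b ∣ p/d < e , a^d ≤ n^p b^d }.
power : (n : ℕ) → .{{NonZero n}} → (e : ℝ) → 0ℝ < e → ℝ
power n e (q₀ , 0≤q₀ , q₀<e) = sup P nonempty ub
  where
  P : ℚ → Set
  P z = ∃₂ λ p d → ∃₂ λ a b →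
    Below e (+ p ℚ./ suc d) ×
    z ≡ + a ℚ./ suc b ×
    a ℕ.^ suc d ℕ.≤ n ℕ.^ p ℕ.* suc b ℕ.^ suc d

  nonempty : ∃ P
  nonempty = 0ℚ , 0 , 0 , 0 , 0
    , ℝ.downward e (ℚ.≮⇒≥ 0≤q₀) q₀<e , refl , ℕ.z≤n

  u = proj₁ (ℝ.bounded e)
  m = proj₁ (ceil u)

  ub : ∃ λ b → ∀ q → P q → q ℚ.≤ b
  ub = + (n ℕ.^ m) ℚ./ 1 , λ { _ (p , d , a , b , p/d<e , refl , a^d≤) →
    let p/d≤u = ℚ.≮⇒≥ λ u<p/d → proj₂ (ℝ.bounded e) (ℝ.downward e (ℚ.<⇒≤ u<p/d) p/d<e)
        p≤md  = frac-≤⁻¹ p m d (ℚ.≤-trans p/d≤u (proj₂ (ceil u)))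
        D     = suc d
        B     = suc b
    in frac-≤ a (n ℕ.^ m) b (^-cancelˡ-≤ d (ℕ.≤-trans a^d≤
         (ℕ.≤-trans (ℕ.*-monoˡ-≤ (B ℕ.^ D) (ℕ.^-monoʳ-≤ n p≤md))
         (ℕ.≤-reflexive
           (trans (cong (ℕ._* B ℕ.^ D) (sym (ℕ.^-*-assoc n m D)))
                  (sym (^-distribʳ-* D (n ℕ.^ m) B))))))) }

record ℝ>0 : Set₁ where
  constructor _,>0_
  field
    value    : ℝ
    positive : 0ℝ < value

record ℝ≥0 : Set₁ where
  constructor _,≥0_
  field
    value       : ℝ
    nonnegative : 0ℝ ≤ value

fromℕ⁺ : (n : ℕ) → .{{NonZero n}} → ℝ>0
fromℕ⁺ n = fromℕ n ,>0 (0ℚ , ℚ.<-irrefl refl , ℚ.positive⁻¹ _ {{ℚ.normalize-pos n 1}})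

_^_ : (n : ℕ) → .{{NonZero n}} → ℝ>0 → ℝ
n ^ (e ,>0 e>0) = power n e e>0

-- m = ⌊ x ⌋ for x ≥ 0
IsFloor : ℝ → ℕ → Set
IsFloor x m = fromℕ m ≤ x × x < fromℕ (suc m)

_⟨_⟩ : (ℝ>0 → ℝ≥0) → (n : ℕ) → .{{NonZero n}} → ℝ
f ⟨ n ⟩ = ℝ≥0.value (f (fromℕ⁺ n))

NonDecreasing : (ℝ>0 → ℝ≥0) → Set₁
NonDecreasing f = ∀ x y → ℝ>0.value x ≤ ℝ>0.value y →
                  ℝ≥0.value (f x) ≤ ℝ≥0.value (f y)

_IsΩ^_ : (ℝ>0 → ℝ≥0) → ℝ>0 → Set₁
f IsΩ^ e = ∃ λ (a : ℝ) → 0ℝ < a × ∃ λ N →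
  ∀ n .{{_ : NonZero n}} → N ℕ.≤ n → a · (n ^ e) ≤ f ⟨ n ⟩

-- f(⌊βn⌋) ≤ c f(n) for all sufficiently large n.  Positivity of m = ⌊βn⌋
-- is what makes f(m) meaningful; for β > 0 it holds for all large n.
Contracts : ℝ → (ℝ>0 → ℝ≥0) → ℝ → Set
Contracts β f c = ∃ λ N →
  ∀ n .{{_ : NonZero n}} → N ℕ.≤ n →
  ∀ m .{{_ : NonZero m}} → IsFloor (β · fromℕ n) m → f ⟨ m ⟩ ≤ c · f ⟨ n ⟩

-- Finite simple graphs on n labelled vertices.  "At least one vertex" is
-- imposed by NonZero n wherever a graph is quantified.
record Graph (n : ℕ) : Set₁ where
  field
    _∼_    : Rel (Fin n) 0ℓ
    _∼?_   : Decidable _∼_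
    sym-∼  : Symmetric _∼_
    irrefl : Irreflexive _≡_ _∼_

module _ {n : ℕ} (G : Graph n) where
  open Graph G

  IsClique IsIndependent : Subset n → Set
  IsClique      S = ∀ {u v} → u ∈ S → v ∈ S → u ≢ v → u ∼ v
  IsIndependent S = ∀ {u v} → u ∈ S → v ∈ S → ¬ u ∼ v

  IsSeparation : Subset n → Subset n → Set
  IsSeparation A B =
    A ∪ B ≡ ⊤ × (∀ {u v} → u ∈ A ─ B → v ∈ B ─ A → ¬ u ∼ v)

  IsBalanced : ℝ → Subset n → Subset n → Set
  IsBalanced β A B = fromℕ (∣ A ─ B ∣ ℕ.⊔ ∣ B ─ A ∣) ≤ β · fromℕ n

  IsCliqueBasedSeparator : ℝ → List (Subset n) → Set
  IsCliqueBasedSeparator β 𝒮 =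
    All IsClique 𝒮 ×
    AllPairs (λ S S′ → Empty (S ∩ S′)) 𝒮 ×
    ∃₂ λ A B → IsSeparation A B × IsBalanced β A B × ⋃ 𝒮 ≡ A ∩ B

  IsConnected : Set
  IsConnected = ∀ u v → Star _∼_ u v

  -- The cycle x, xs₁, …, xsₖ, x.
  IsCycle : Fin n → List (Fin n) → Set
  IsCycle x xs = 2 ℕ.≤ length xs × Unique (x ∷ xs) × Linked _∼_ (x ∷ xs ++ x ∷ [])

  IsTree : Set
  IsTree = IsConnected × (∀ x xs → ¬ IsCycle x xs)

-- G − v, with the remaining vertices relabelled in increasing order.
delete : ∀ {n} → Graph (suc n) → Fin (suc n) → Graph n
delete G v = record
  { _∼_    = _∼_ on punchIn v
  ; _∼?_   = λ x y → punchIn v x ∼? punchIn v y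
  ; sym-∼  = sym-∼
  ; irrefl = λ { refl → irrefl refl }
  }
  where open Graph G

-- Graph classes need not be closed under relabelling of the vertices, so
-- the isomorphism-closed ones are a special case.
GraphClass : (ℓ : Level) → Set (lsuc ℓ)
GraphClass ℓ = ∀ {n} → .{{NonZero n}} → Graph n → Set ℓ

Hereditary : ∀ {ℓ} → GraphClass ℓ → Set (lsuc 0ℓ Level.⊔ ℓ)
Hereditary 𝒢 = ∀ {n} .{{_ : NonZero n}} (G : Graph (suc n)) v → 𝒢 G → 𝒢 (delete G v)

IsMinimum IsMaximum : ∀ {ℓ} → (ℕ → Set ℓ) → ℕ → Set ℓ
IsMinimum P k = P k × (∀ {j} → P j → k ℕ.≤ j)
IsMaximum P k = P k × (∀ {j} → P j → j ℕ.≤ k)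

record TreeDecomposition {n : ℕ} (G : Graph n) : Set₁ where
  open Graph G using (_∼_)
  field
    {size}       : ℕ
    .{{nonZero}} : NonZero size
    tree         : Graph size
    isTree       : IsTree tree
    bag          : Fin size → Subset n
    vertexCover  : ∀ u → ∃ λ t → u ∈ bag t
    edgeCover    : ∀ {u v} → u ∼ v → ∃ λ t → u ∈ bag t × v ∈ bag t
    connected    : ∀ u {s t} → u ∈ bag s → u ∈ bag t →
                   Star (λ s′ t′ → Graph._∼_ tree s′ t′ × u ∈ bag s′ × u ∈ bag t′) s t

module _ {n : ℕ} (G : Graph n) where

  -- k = α(G[X]): the independent sets of G[X] are those of G contained in X.
  IsIndependenceNumberOn : Subset n → ℕ → Set
  IsIndependenceNumberOn X =
    IsMaximum λ k → ∃ λ I → I ⊆ X × IsIndependent G I × ∣ I ∣ ≡ k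

  IsIndependenceNumberTD : TreeDecomposition G → ℕ → Set
  IsIndependenceNumberTD 𝒯 =
    IsMaximum λ k → ∃ λ t → IsIndependenceNumberOn (TreeDecomposition.bag 𝒯 t) k

  IsTreeIndependenceNumber : ℕ → Set₁
  IsTreeIndependenceNumber =
    IsMinimum λ k → ∃ λ 𝒯 → IsIndependenceNumberTD 𝒯 k

-- The tree-independence number is unique, and it exists (classically: a
-- minimum of an infinite family need not be computable).

tree-independence-unique : ∀ {n} (G : Graph n) {j k} →
  IsTreeIndependenceNumber G j → IsTreeIndependenceNumber G k → j ≡ k
tree-independence-unique G (Pj , j≤) (Pk , k≤) = ℕ.≤-antisym (j≤ Pk) (k≤ Pj)

private
  ¬¬-minimum : ∀ {ℓ} (P : ℕ → Set ℓ) → ∃ P → ¬ ¬ ∃ (IsMinimum P)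
  ¬¬-minimum P (k , Pk) ¬min = none (suc k) k ℕ.≤-refl Pk
    where
    none : ∀ b j → j ℕ.< b → ¬ P j
    none (suc b) j (ℕ.s≤s j≤b) Pj =
      ¬min (j , Pj , λ {i} Pi → ℕ.≮⇒≥ λ i<j → none b i (ℕ.<-≤-trans i<j j≤b) Pi)

  ¬¬-maximum : ∀ {ℓ} (P : ℕ → Set ℓ) b → (∀ {k} → P k → k ℕ.≤ b) →
               ∃ P → ¬ ¬ ∃ (IsMaximum P)
  ¬¬-maximum P b ≤b (k , Pk) ¬max = none (suc b ℕ.∸ k) k ℕ.≤-refl Pk
    where
    none : ∀ d j → suc b ℕ.∸ j ℕ.≤ d → ¬ P j
    none zero    j le Pj = ℕ.<⇒≱ (ℕ.s≤s (≤b Pj)) (ℕ.m∸n≡0⇒m≤n (ℕ.n≤0⇒n≡0 le))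
    none (suc d) j le Pj = ¬max (j , Pj , λ {i} Pi → ℕ.≮⇒≥ λ j<i →
      none d i (ℕ.≤-pred (ℕ.<-≤-trans (ℕ.∸-monoʳ-< j<i (ℕ.m≤n⇒m≤1+n (≤b Pi))) le)) Pi)

  trivialTD : ∀ {n} (G : Graph n) → TreeDecomposition G
  trivialTD G = record
    { size        = 1
    ; tree        = record { _∼_    = λ _ _ → Empty.⊥
                           ; _∼?_   = λ _ _ → no λ ()
                           ; sym-∼  = λ ()
                           ; irrefl = λ _ () }
    ; isTree      = (λ { Fin.zero Fin.zero → ε }) , λ { x (y ∷ xs) (_ , _ , () ∷ _) }
    ; bag         = λ _ → ⊤
    ; vertexCover = λ _ → Fin.zero , ∈⊤
    ; edgeCover   = λ _ → Fin.zero , ∈⊤ , ∈⊤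
    ; connected   = λ { _ {Fin.zero} {Fin.zero} _ _ → ε }
    }

tree-independence-exists : ∀ {n} (G : Graph n) → ¬ ¬ ∃ (IsTreeIndependenceNumber G)
tree-independence-exists {n} G ¬∃ =
  ¬¬-maximum (λ k → ∃ λ I → I ⊆ ⊤ × IsIndependent G I × ∣ I ∣ ≡ k) n
    (λ { (I , _ , _ , refl) → ∣p∣≤n I })
    (_ , ⊥ , (λ _ → ∈⊤) , (λ u∈⊥ → contradiction u∈⊥ ∉⊥) , refl)
    λ (k , α) → ¬¬-minimum (λ k → ∃ λ 𝒯 → IsIndependenceNumberTD G 𝒯 k)
      (k , trivialTD G , (Fin.zero , α) , λ { (_ , (P , _)) → proj₂ α P })
      ¬∃

{-# OPTIONS --safe #-}

-- Split G along a separator S, a union of O(f(n)) cliques.  Decompose both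
-- sides recursively, join the two trees by an edge and add S to every bag: an
-- independent set meets S in at most one vertex per clique, so each level of the
-- recursion costs O(f(n)).  Since β < 1 there are O(log n) levels.  If
-- f(⌊βn⌋) ≤ c f(n), the costs form a geometric series, started at a bounded
-- number of vertices, where boundedly many levels suffice.
--
-- The bounds are carried as rationals K r, where r ranges over the rational
-- upper bounds of f(n); only the final inequalities are between reals.

module Submission where

open import Defs
open import Data.Empty using (⊥)
open import Data.Fin.Base using (Fin; zero; suc; punchIn)
open import Data.Fin.Properties
  using (any?; ¬Fin0; _≟_; punchIn-injective; punchIn-punchOut; nonZeroIndex; +↔⊎; inj⇒≟)
open import Data.Fin.Subset as Subset
  using (Subset; inside; outside; _∈_; _∉_; _⊆_; _∩_; _∪_; _─_; ⋃; ⁅_⁆; ∣_∣; ⊤; Nonempty)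
open import Data.Fin.Subset.Properties
open import Data.Integer.Base as ℤ using (+_; -[1+_])
import Data.Integer.Properties as ℤ
open import Data.List.Base using (List; []; _∷_; _++_; length)
open import Data.List.Relation.Unary.All as All using (All; []; _∷_)
open import Data.List.Relation.Unary.AllPairs using (_∷_)
open import Data.List.Relation.Unary.Linked using (Linked; _∷_)
open import Data.List.Relation.Unary.Unique.Propositional using (Unique)
open import Data.Nat.Base as ℕ using (ℕ; zero; suc; NonZero)
import Data.Nat.Properties as ℕ
open import Data.Nat.Tactic.RingSolver using (solve-∀)
open import Data.Product.Base using (∃; _×_; _,_; proj₁; proj₂)
open import Data.Rational.Base as ℚ using (ℚ; mkℚ; 0ℚ; 1ℚ; _*_; _+_)
import Data.Rational.Properties as ℚ
import Data.Rational.Solver as ℚSolver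
import Data.Rational.Unnormalised.Base as ℚᵘ
import Data.Rational.Unnormalised.Properties as ℚᵘ
open import Data.Sum.Base using (_⊎_; inj₁; inj₂; [_,_]′)
open import Data.Sum.Function.Propositional using (_⊎-↔_)
open import Data.Vec.Base using ([]; _∷_; here; there; tabulate; removeAt)
open import Data.Vec.Properties using (lookup∘tabulate; lookup⇒[]=; []=⇒lookup)
open import Function.Base using (_∘_; _on_; id)
open import Function.Bundles using (_↔_; Inverse)
open import Function.Construct.Composition using (_↔-∘_)
open import Function.Construct.Identity using (↔-id)
open import Function.Construct.Symmetry using (↔-sym)
open import Function.Properties.Inverse using (↔⇒↣)
open import Level using (Level; 0ℓ; _⊔_) renaming (suc to lsuc)
open import Relation.Binary.Construct.Closure.ReflexiveTransitive as Star
  using (Star; ε; _◅_; _◅◅_)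
open import Relation.Binary.Core using (Rel)
open import Relation.Binary.Definitions using (Decidable; Symmetric; tri<; tri≈; tri>)
open import Relation.Binary.PropositionalEquality hiding (J)
open import Relation.Nullary
open import Relation.Nullary.Decidable using (dec-true; decidable-stable)

-- The recursion runs on `A ─ B` and `B ─ A` alone. The separator re-enters every bag, so its
-- vertices are not passed down, and a part with m vertices satisfies m ≤ βn, hence is strictly
-- smaller. A side may be empty, so the graph on no vertices needs a decomposition too; membership
-- in the class and bounds on f are then asked for only when there is a vertex.
--
-- Cuts cannot be compared or rounded constructively. Therefore β and c give way at once to
-- rationals k/(k+1) and l/(l+1) above them: sizes then shrink by the integer inequality (k+1)m ≤
-- kn, and the geometric series sums to l+1.

private variable
  ℓ : Level
  m n : ℕ

-- Finite subsets and their images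

x∈p─q⇒x∉q : ∀ {x : Fin n} (p q : Subset n) → x ∈ p ─ q → x ∉ q
x∈p─q⇒x∉q (_ ∷ p) (inside  ∷ q) (there x∈) (there x∈q) = x∈p─q⇒x∉q p q x∈ x∈q
x∈p─q⇒x∉q (_ ∷ p) (outside ∷ q) (there x∈) (there x∈q) = x∈p─q⇒x∉q p q x∈ x∈q

∣p∣≤∣p─q∣+∣p∩q∣ : (p q : Subset n) → ∣ p ∣ ℕ.≤ ∣ p ─ q ∣ ℕ.+ ∣ p ∩ q ∣
∣p∣≤∣p─q∣+∣p∩q∣ []            []            = ℕ.z≤n
∣p∣≤∣p─q∣+∣p∩q∣ (inside  ∷ p) (inside  ∷ q) =
  ℕ.≤-trans (ℕ.s≤s (∣p∣≤∣p─q∣+∣p∩q∣ p q)) (ℕ.≤-reflexive (sym (ℕ.+-suc _ _)))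
∣p∣≤∣p─q∣+∣p∩q∣ (inside  ∷ p) (outside ∷ q) = ℕ.s≤s (∣p∣≤∣p─q∣+∣p∩q∣ p q)
∣p∣≤∣p─q∣+∣p∩q∣ (outside ∷ p) (inside  ∷ q) = ∣p∣≤∣p─q∣+∣p∩q∣ p q
∣p∣≤∣p─q∣+∣p∩q∣ (outside ∷ p) (outside ∷ q) = ∣p∣≤∣p─q∣+∣p∩q∣ p q

Empty⇒∣p∣≡0 : {p : Subset n} → ¬ Nonempty p → ∣ p ∣ ≡ 0
Empty⇒∣p∣≡0 {n} p-empty = trans (cong ∣_∣ (Empty-unique p-empty)) (∣⊥∣≡0 n)

select : {P : Fin n → Set ℓ} → (∀ i → Dec (P i)) → Subset n
select P? = tabulate (does ∘ P?)

module _ {P : Fin n → Set ℓ} (P? : ∀ i → Dec (P i)) where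

  ∈-select⁺ : ∀ {i} → P i → i ∈ select P?
  ∈-select⁺ {i} p =
    lookup⇒[]= i _ (trans (lookup∘tabulate (does ∘ P?) i) (dec-true (P? i) p))

  ∈-select⁻ : ∀ {i} → i ∈ select P? → P i
  ∈-select⁻ {i} i∈ with P? i | trans (sym (lookup∘tabulate (does ∘ P?) i)) ([]=⇒lookup i∈)
  ... | yes p | _ = p

preimage : (Fin m → Fin n) → Subset n → Subset m
preimage g S = select (λ x → g x ∈? S)

inImage? : (g : Fin m → Fin n) (J : Subset m) (u : Fin n) → Dec (∃ λ x → x ∈ J × g x ≡ u)
inImage? g J u = any? λ x → (x ∈? J) ×-dec (g x ≟ u)

image : (Fin m → Fin n) → Subset m → Subset n
image g J = select (inImage? g J)

∣image∣≤ : (g : Fin m → Fin n) (J : Subset m) {I : Subset n} →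
           (∀ {u} → u ∈ I → ∃ λ x → x ∈ J × g x ≡ u) → ∣ I ∣ ℕ.≤ ∣ J ∣
∣image∣≤ g [] {I} onto =
  ℕ.≤-reflexive (Empty⇒∣p∣≡0 λ (_ , u∈I) → ¬Fin0 (proj₁ (onto u∈I)))
∣image∣≤ g (outside ∷ J) onto = ∣image∣≤ (g ∘ suc) J λ u∈I → tail (onto u∈I)
  where
  tail : ∀ {u} → (∃ λ x → x ∈ outside ∷ J × g x ≡ u) → ∃ λ x → x ∈ J × g (suc x) ≡ u
  tail (suc x , there x∈J , eq) = x , x∈J , eq
∣image∣≤ g (inside ∷ J) {I} onto = begin
  ∣ I ∣                                   ≤⟨ ∣p∣≤∣p─q∣+∣p∩q∣ I v ⟩
  ∣ I ─ v ∣ ℕ.+ ∣ I ∩ v ∣                 ≤⟨ ℕ.+-mono-≤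
    (∣image∣≤ (g ∘ suc) J λ u∈ →
      tail (x∈p─q⇒x∉q I v u∈) (onto (p─q⊆p I v u∈)))
    (ℕ.≤-trans (∣p∩q∣≤∣q∣ I v) (ℕ.≤-reflexive (∣⁅x⁆∣≡1 (g zero)))) ⟩
  ∣ J ∣ ℕ.+ 1                             ≡⟨ ℕ.+-comm ∣ J ∣ 1 ⟩
  suc ∣ J ∣                               ∎
  where
  open ℕ.≤-Reasoning
  v = ⁅ g zero ⁆
  tail : ∀ {u} → u ∉ v → (∃ λ x → x ∈ inside ∷ J × g x ≡ u) →
         ∃ λ x → x ∈ J × g (suc x) ≡ u
  tail u∉v (zero  , _         , refl) = contradiction (x∈⁅x⁆ _) u∉v
  tail u∉v (suc x , there x∈J , eq)   = x , x∈J , eq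

-- Independent sets against unions of cliques

module _ (G : Graph n) where

  ∣independent∩clique∣≤1 : ∀ {I S} → IsIndependent G I → IsClique G S → ∣ I ∩ S ∣ ℕ.≤ 1
  ∣independent∩clique∣≤1 {I} {S} I-ind S-cl with nonempty? (I ∩ S)
  ... | no  empty     = ℕ.≤-trans (ℕ.≤-reflexive (Empty⇒∣p∣≡0 empty)) ℕ.z≤n
  ... | yes (v , v∈∩) =
    ℕ.≤-trans (p⊆q⇒∣p∣≤∣q∣ ⊆v) (ℕ.≤-reflexive (∣⁅x⁆∣≡1 v))
    where
    ⊆v : I ∩ S ⊆ ⁅ v ⁆
    ⊆v {u} u∈∩ with u ≟ v
    ... | yes refl = x∈⁅x⁆ u
    ... | no  u≢v  =
      let u∈I , u∈S = x∈p∩q⁻ I S u∈∩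
          v∈I , v∈S = x∈p∩q⁻ I S v∈∩
      in contradiction (S-cl u∈S v∈S u≢v) (I-ind u∈I v∈I)

  independent-⊆ : ∀ {I J} → J ⊆ I → IsIndependent G I → IsIndependent G J
  independent-⊆ J⊆I I-ind u∈J v∈J = I-ind (J⊆I u∈J) (J⊆I v∈J)

  ∣independent∣≤ : ∀ 𝒮 {I} → All (IsClique G) 𝒮 → IsIndependent G I →
                   ∣ I ∣ ℕ.≤ length 𝒮 ℕ.+ ∣ I ─ ⋃ 𝒮 ∣
  ∣independent∣≤ []      {I} []             I-ind =
    ℕ.≤-reflexive (sym (cong ∣_∣ (p─⊥≡p I)))
  ∣independent∣≤ (S ∷ 𝒮) {I} (S-cl ∷ 𝒮-cl) I-ind = begin
    ∣ I ∣                                   ≤⟨ ∣p∣≤∣p─q∣+∣p∩q∣ I S ⟩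
    ∣ I ─ S ∣ ℕ.+ ∣ I ∩ S ∣                 ≤⟨ ℕ.+-mono-≤
      (∣independent∣≤ 𝒮 𝒮-cl (independent-⊆ (p─q⊆p I S) I-ind))
      (∣independent∩clique∣≤1 I-ind S-cl) ⟩
    length 𝒮 ℕ.+ ∣ I ─ S ─ ⋃ 𝒮 ∣ ℕ.+ 1      ≡⟨ ℕ.+-comm _ 1 ⟩
    suc (length 𝒮 ℕ.+ ∣ I ─ S ─ ⋃ 𝒮 ∣)      ≡⟨ cong (λ J → suc (length 𝒮 ℕ.+ ∣ J ∣))
                                                    (p─q─r≡p─q∪r I S (⋃ 𝒮)) ⟩
    suc (length 𝒮 ℕ.+ ∣ I ─ (S ∪ ⋃ 𝒮) ∣)    ∎
    where open ℕ.≤-Reasoning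

-- Induced subgraphs within a hereditary class

record Induced (𝒢 : GraphClass ℓ) (G : Graph n) (S : Subset n) : Set (lsuc 0ℓ ⊔ ℓ) where
  field
    {order}     : ℕ
    graph       : Graph order
    -- `S` may be empty, and a graph class says nothing about the graph on no vertices.
    member      : .{{_ : NonZero order}} → 𝒢 graph
    ι           : Fin order → Fin n
    ι-injective : ∀ {x y} → ι x ≡ ι y → x ≡ y
    ι-∈         : ∀ x → ι x ∈ S
    ι-onto      : ∀ {u} → u ∈ S → ∃ λ x → ι x ≡ u
    ι-adjacent⁺ : ∀ {x y} → Graph._∼_ graph x y → Graph._∼_ G (ι x) (ι y)
    ι-adjacent⁻ : ∀ {x y} → Graph._∼_ G (ι x) (ι y) → Graph._∼_ graph x y
    order≤∣S∣   : order ℕ.≤ ∣ S ∣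


∣removeAt∣≤ : ∀ (S : Subset (suc n)) v → ∣ removeAt S v ∣ ℕ.≤ ∣ S ∣
∣removeAt∣≤ (s ∷ S)           zero    = ∣p∣≤∣x∷p∣ s S
∣removeAt∣≤ (inside  ∷ S@(_ ∷ _)) (suc v) = ℕ.s≤s (∣removeAt∣≤ S v)
∣removeAt∣≤ (outside ∷ S@(_ ∷ _)) (suc v) = ∣removeAt∣≤ S v

∈-removeAt⁺ : ∀ (S : Subset (suc n)) v {x} → punchIn v x ∈ S → x ∈ removeAt S v
∈-removeAt⁺ (_ ∷ S)         zero            (there x∈) = x∈
∈-removeAt⁺ (_ ∷ S@(_ ∷ _)) (suc v) {zero}  here       = here
∈-removeAt⁺ (_ ∷ S@(_ ∷ _)) (suc v) {suc x} (there x∈) = there (∈-removeAt⁺ S v x∈)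

∈-removeAt⁻ : ∀ (S : Subset (suc n)) v {x} → x ∈ removeAt S v → punchIn v x ∈ S
∈-removeAt⁻ (_ ∷ S)         zero            x∈         = there x∈
∈-removeAt⁻ (_ ∷ S@(_ ∷ _)) (suc v) {zero}  here       = here
∈-removeAt⁻ (_ ∷ S@(_ ∷ _)) (suc v) {suc x} (there x∈) = there (∈-removeAt⁻ S v x∈)

-- Heredity removes one vertex at a time: as long as some `v` is missing from `S`, delete it from
-- the graph together with its entry in `S`, and compose the embedding with `punchIn v`.
induce : (𝒢 : GraphClass ℓ) → Hereditary 𝒢 → (G : Graph n) →
         (.{{_ : NonZero n}} → 𝒢 G) → (S : Subset n) → Induced 𝒢 G S
induce {n = n} 𝒢 hereditary G G∈𝒢 S with any? (λ v → ¬? (v ∈? S))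
... | no  S-full = record
  { graph       = G
  ; member      = G∈𝒢
  ; ι           = id
  ; ι-injective = id
  ; ι-∈         = ∈S
  ; ι-onto      = λ {u} _ → u , refl
  ; ι-adjacent⁺ = id
  ; ι-adjacent⁻ = id
  ; order≤∣S∣   = ℕ.≤-trans (ℕ.≤-reflexive (sym (∣⊤∣≡n n))) (p⊆q⇒∣p∣≤∣q∣ {p = ⊤} λ {u} _ → ∈S u)
  }
  where
  ∈S : ∀ u → u ∈ S
  ∈S u = decidable-stable (u ∈? S) λ u∉S → S-full (u , u∉S)
induce {n = suc n} 𝒢 hereditary G G∈𝒢 S | yes (v , v∉S) = record
  { graph       = graph
  ; member      = member
  ; ι           = punchIn v ∘ ι
  ; ι-injective = ι-injective ∘ punchIn-injective v _ _
  ; ι-∈         = ∈-removeAt⁻ S v ∘ ι-∈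
  ; ι-onto      = λ {u} u∈S →
      let v≢u     = λ { refl → v∉S u∈S }
          u≡      = punchIn-punchOut v≢u
          x , x≡  = ι-onto (∈-removeAt⁺ S v (subst (_∈ S) (sym u≡) u∈S))
      in x , trans (cong (punchIn v) x≡) u≡
  ; ι-adjacent⁺ = ι-adjacent⁺
  ; ι-adjacent⁻ = ι-adjacent⁻
  ; order≤∣S∣   = ℕ.≤-trans order≤∣S∣ (∣removeAt∣≤ S v)
  }
  where
  open Induced (induce 𝒢 hereditary (delete G v) (hereditary G v G∈𝒢) (removeAt S v))

-- Depth in a rooted tree.  In a cycle, a step away from the root can only be
-- followed by another one, so a cycle would reach its base point twice from
-- a vertex closer to the root, that is, through the same edge.
module _ {A : Set} (_∼_ : Rel A 0ℓ) (depth : A → ℕ)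
  (depth-≢ : ∀ {u v} → u ∼ v → depth u ≢ depth v)
  (parent-unique : ∀ {u v w} → u ∼ w → v ∼ w → depth u ℕ.< depth w → depth v ℕ.< depth w → u ≡ v)
  (sym-∼ : Symmetric _∼_)
  where

  private
    infix 4 _↑_
    _↑_ : A → A → Set
    u ↑ v = depth u ℕ.< depth v

    orient : ∀ {u v} → u ∼ v → u ↑ v ⊎ v ↑ u
    orient {u} {v} u∼v with ℕ.<-cmp (depth u) (depth v)
    ... | tri< u<v _ _ = inj₁ u<v
    ... | tri≈ _ u≡v _ = contradiction u≡v (depth-≢ u∼v)
    ... | tri> _ _ v<u = inj₂ v<u

    last : A → List A → A
    last a []       = a
    last a (b ∷ bs) = last b bs

    last-All : ∀ {P : A → Set} a bs → All P (a ∷ bs) → P (last a bs)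
    last-All a []       (p ∷ _)  = p
    last-All a (b ∷ bs) (_ ∷ ps) = last-All b bs ps

    last∼ : ∀ a bs z → Linked _∼_ (a ∷ bs ++ z ∷ []) → last a bs ∼ z
    last∼ a []       z (a∼z ∷ _) = a∼z
    last∼ a (b ∷ bs) z (_ ∷ w)   = last∼ b bs z w

    onward : ∀ {a b c} → a ∼ b → b ∼ c → a ≢ c → a ↑ b → b ↑ c
    onward a∼b b∼c a≢c a↑b with orient b∼c
    ... | inj₁ b↑c = b↑c
    ... | inj₂ c↑b = contradiction (parent-unique a∼b (sym-∼ b∼c) a↑b c↑b) a≢c

    ascend : ∀ {a b z} bs → a ∼ b → a ↑ b → Linked _∼_ (b ∷ bs ++ z ∷ []) →
             Unique (a ∷ b ∷ bs) → All (_≢ z) (a ∷ b ∷ bs) →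
             b ↑ z × last b bs ↑ z
    ascend []       a∼b a↑b (b∼z ∷ _) _ (a≢z ∷ _) =
      let b↑z = onward a∼b b∼z a≢z a↑b in b↑z , b↑z
    ascend (c ∷ bs) a∼b a↑b (b∼c ∷ walk) ((_ ∷ a≢c ∷ _) ∷ uniq) (_ ∷ ≢z) =
      let b↑c         = onward a∼b b∼c a≢c a↑b
          c↑z , last↑z = ascend bs b∼c b↑c walk uniq ≢z
      in ℕ.<-trans b↑c c↑z , last↑z

    -- A walk to `z` has at most one turning point, from descent to ascent. Either it never turns,
    -- and `z` lies below its start, or it turns and arrives at `z` from below.
    descend-or-ascend : ∀ {a z} bs → Linked _∼_ (a ∷ bs ++ z ∷ []) → Unique (a ∷ bs) →
                        All (_≢ z) (a ∷ bs) → z ↑ a ⊎ last a bs ↑ z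
    descend-or-ascend [] (a∼z ∷ _) _ _ with orient a∼z
    ... | inj₁ a↑z = inj₂ a↑z
    ... | inj₂ z↑a = inj₁ z↑a
    descend-or-ascend (b ∷ bs) (a∼b ∷ walk) uniq@(_ ∷ uniq′) ≢z@(_ ∷ ≢z′) with orient a∼b
    ... | inj₁ a↑b = inj₂ (proj₂ (ascend bs a∼b a↑b walk uniq ≢z))
    ... | inj₂ b↑a with descend-or-ascend bs walk uniq′ ≢z′
    ...   | inj₁ z↑b    = inj₁ (ℕ.<-trans z↑b b↑a)
    ...   | inj₂ last↑z = inj₂ last↑z

  no-closed-walk : ∀ x xs → 2 ℕ.≤ length xs → Unique (x ∷ xs) →
                   ¬ Linked _∼_ (x ∷ xs ++ x ∷ [])
  no-closed-walk x (y ∷ []) (ℕ.s≤s ())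
  no-closed-walk x (y ∷ z ∷ zs) _ ((x≢y ∷ x≢z ∷ x≢zs) ∷ uniq@(y≢ ∷ _)) (x∼y ∷ walk@(y∼z ∷ walk′))
    with orient x∼y
  -- A first step upward forces ascent all the way round, back to `x`.
  ... | inj₁ x↑y = ℕ.<-asym x↑y (ℕ.<-trans y↑z z↑x)
    where
    y↑z = onward x∼y y∼z x≢z x↑y
    z↑x = proj₁ (ascend zs y∼z y↑z walk′ uniq (All.map (λ x≢ eq → x≢ (sym eq)) (x≢y ∷ x≢z ∷ x≢zs)))
  ... | inj₂ y↑x
    with descend-or-ascend (z ∷ zs) walk uniq (All.map (λ x≢ eq → x≢ (sym eq)) (x≢y ∷ x≢z ∷ x≢zs))
  ...   | inj₁ x↑y    = ℕ.<-asym x↑y y↑x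
  ...   | inj₂ last↑x =
    -- Both neighbours of `x` on the cycle are now its parent, so they coincide although the
    -- vertices of the cycle are distinct.
    last-All z zs y≢ (parent-unique (sym-∼ x∼y) (last∼ y (z ∷ zs) x walk) y↑x last↑x)

-- Rational arithmetic

⌜_⌝ : ℕ → ℚ
⌜ n ⌝ = + n ℚ./ 1

toℚᵘ-⌜⌝ : ∀ n → ℚ.toℚᵘ ⌜ n ⌝ ℚᵘ.≃ ℚᵘ.mkℚᵘ (+ n) 0
toℚᵘ-⌜⌝ n = ℚ.toℚᵘ-fromℚᵘ (ℚᵘ.mkℚᵘ (+ n) 0)

⌜⌝-mono-≤ : ∀ {m n} → m ℕ.≤ n → ⌜ m ⌝ ℚ.≤ ⌜ n ⌝
⌜⌝-mono-≤ {m} {n} m≤n = ℚ.toℚᵘ-cancel-≤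
  (ℚᵘ.≤-respˡ-≃ (ℚᵘ.≃-sym (toℚᵘ-⌜⌝ m)) (ℚᵘ.≤-respʳ-≃ (ℚᵘ.≃-sym (toℚᵘ-⌜⌝ n))
    (ℚᵘ.*≤* (ℤ.*-monoʳ-≤-nonNeg (+ 1) (ℤ.+≤+ m≤n)))))

⌜⌝-cancel-≤ : ∀ {m n} → ⌜ m ⌝ ℚ.≤ ⌜ n ⌝ → m ℕ.≤ n
⌜⌝-cancel-≤ {m} {n} le
  with ℚᵘ.≤-respˡ-≃ (toℚᵘ-⌜⌝ m) (ℚᵘ.≤-respʳ-≃ (toℚᵘ-⌜⌝ n) (ℚ.toℚᵘ-mono-≤ le))
... | ℚᵘ.*≤* le′ = ℤ.drop‿+≤+ (ℤ.*-cancelʳ-≤-pos (+ m) (+ n) (+ 1) le′)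

⌜⌝-+ : ∀ m n → ⌜ m ℕ.+ n ⌝ ≡ ⌜ m ⌝ ℚ.+ ⌜ n ⌝
⌜⌝-+ m n = ℚ.toℚᵘ-injective (ℚᵘ.≃-trans (toℚᵘ-⌜⌝ (m ℕ.+ n)) (ℚᵘ.≃-trans
  (ℚᵘ.*≡* (cong (ℤ._* + 1) (sym (cong₂ ℤ._+_ (ℤ.*-identityʳ (+ m)) (ℤ.*-identityʳ (+ n))))))
  (ℚᵘ.≃-sym (ℚᵘ.≃-trans (ℚ.toℚᵘ-homo-+ ⌜ m ⌝ ⌜ n ⌝) (ℚᵘ.+-cong (toℚᵘ-⌜⌝ m) (toℚᵘ-⌜⌝ n))))))

⌜⌝-* : ∀ m n → ⌜ m ℕ.* n ⌝ ≡ ⌜ m ⌝ ℚ.* ⌜ n ⌝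
⌜⌝-* m n = ℚ.toℚᵘ-injective (ℚᵘ.≃-trans (toℚᵘ-⌜⌝ (m ℕ.* n)) (ℚᵘ.≃-trans
  (ℚᵘ.*≡* (cong (ℤ._* + 1) (ℤ.pos-* m n)))
  (ℚᵘ.≃-sym (ℚᵘ.≃-trans (ℚ.toℚᵘ-homo-* ⌜ m ⌝ ⌜ n ⌝) (ℚᵘ.*-cong (toℚᵘ-⌜⌝ m) (toℚᵘ-⌜⌝ n))))))

<⇒≱ : ∀ {p q} → p ℚ.< q → ¬ q ℚ.≤ p
<⇒≱ p<q q≤p = ℚ.<-irrefl refl (ℚ.<-≤-trans p<q q≤p)

*-monoˡ : ∀ {p q r} → 0ℚ ℚ.≤ r → p ℚ.≤ q → r * p ℚ.≤ r * q
*-monoˡ {r = r} 0≤r = ℚ.*-monoˡ-≤-nonNeg r {{ℚ.nonNegative 0≤r}}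

*-monoʳ : ∀ {p q r} → 0ℚ ℚ.≤ r → p ℚ.≤ q → p * r ℚ.≤ q * r
*-monoʳ {r = r} 0≤r = ℚ.*-monoʳ-≤-nonNeg r {{ℚ.nonNegative 0≤r}}

*-nonneg : ∀ {p q} → 0ℚ ℚ.≤ p → 0ℚ ℚ.≤ q → 0ℚ ℚ.≤ p * q
*-nonneg {p} {q} 0≤p 0≤q = subst (ℚ._≤ p * q) (ℚ.*-zeroʳ p) (*-monoˡ 0≤p 0≤q)

divide : ∀ p {e} → 0ℚ ℚ.< e → ∃ λ q → e * q ≡ p
divide p {e} 0<e = ℚ.1/ e * p , (begin
  e * (ℚ.1/ e * p)  ≡⟨ ℚ.*-assoc e (ℚ.1/ e) p ⟨
  e * ℚ.1/ e * p    ≡⟨ cong (_* p) (ℚ.*-inverseʳ e) ⟩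
  1ℚ * p            ≡⟨ ℚ.*-identityˡ p ⟩
  p                 ∎)
  where
  open ≡-Reasoning
  instance
    e≢0 : ℚ.NonZero e
    e≢0 = ℚ.pos⇒nonZero e {{ℚ.positive 0<e}}

divide-sign : ∀ {e q} → 0ℚ ℚ.< e → e * q ℚ.< 0ℚ → q ℚ.< 0ℚ
divide-sign {e} {q} 0<e eq<0 = ℚ.≰⇒> λ 0≤q → <⇒≱ eq<0 (*-nonneg (ℚ.<⇒≤ 0<e) 0≤q)

0≤⌜⌝ : ∀ n → 0ℚ ℚ.≤ ⌜ n ⌝
0≤⌜⌝ n = ⌜⌝-mono-≤ {0} {n} ℕ.z≤n

-- Decompositions of bounded independence number

-- The node type is arbitrary, so that two trees can be joined on a disjoint sum;
-- acyclicity is encoded by the depth function.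
record Decomposition {n} (G : Graph n) (x : ℚ) : Set₁ where
  infix 4 _⇄_
  field
    {size}        : ℕ
    Node          : Set
    enumerate     : Node ↔ Fin size
    _⇄_           : Rel Node 0ℓ
    _⇄?_          : Decidable _⇄_
    sym-⇄         : Symmetric _⇄_
    path          : ∀ s t → Star _⇄_ s t
    root          : Node
    depth         : Node → ℕ
    depth-root    : depth root ≡ 0
    depth-≢       : ∀ {s t} → s ⇄ t → depth s ≢ depth t
    parent-unique : ∀ {s t r} → s ⇄ r → t ⇄ r → depth s ℕ.< depth r → depth t ℕ.< depth r → s ≡ t
    bag           : Node → Subset n
    vertexCover   : ∀ u → ∃ λ t → u ∈ bag t
    edgeCover     : ∀ {u v} → Graph._∼_ G u v → ∃ λ t → u ∈ bag t × v ∈ bag t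
    connected     : ∀ u {s t} → u ∈ bag s → u ∈ bag t →
                    Star (λ s′ t′ → s′ ⇄ t′ × u ∈ bag s′ × u ∈ bag t′) s t
    α≤            : ∀ t {I} → I ⊆ bag t → IsIndependent G I → ⌜ ∣ I ∣ ⌝ ℚ.≤ x

relax : ∀ {G : Graph n} {x y} → x ℚ.≤ y → Decomposition G x → Decomposition G y
relax x≤y D = record
  { Decomposition D
  ; α≤ = λ t I⊆ I-ind → ℚ.≤-trans (Decomposition.α≤ D t I⊆ I-ind) x≤y
  }

toTreeDecomposition : ∀ {G : Graph n} {x} → Decomposition G x →
  ∃ λ (𝒯 : TreeDecomposition G) →
    ∀ t {I} → I ⊆ TreeDecomposition.bag 𝒯 t → IsIndependent G I → ⌜ ∣ I ∣ ⌝ ℚ.≤ x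
toTreeDecomposition D = record
  { nonZero     = nonZeroIndex (to root)
  ; tree        = tree
  ; isTree      =
      (λ i j → transport (Star.gmap to to⇄) (path (from i) (from j)))
    , λ x xs (2≤ , uniq , walk) →
        no-closed-walk (Graph._∼_ tree) (depth ∘ from) depth-≢ unique-on-Fin sym-⇄ x xs 2≤ uniq walk
  ; bag         = bag ∘ from
  ; vertexCover = λ u → let t , u∈ = vertexCover u in to t , ∈to u∈
  ; edgeCover   = λ u∼v → let t , u∈ , v∈ = edgeCover u∼v in to t , ∈to u∈ , ∈to v∈
  ; connected   = λ u u∈s u∈t →
      transport (Star.gmap to λ (s⇄t , u∈s , u∈t) → to⇄ s⇄t , ∈to u∈s , ∈to u∈t)
        (connected u u∈s u∈t)
  } , α≤ ∘ from
  where
  open Decomposition D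
  open Inverse enumerate using (to; from)
    renaming (strictlyInverseˡ to to∘from; strictlyInverseʳ to from∘to)

  ∈to : ∀ {u t} → u ∈ bag t → u ∈ bag (from (to t))
  ∈to {t = t} = subst (λ s → _ ∈ bag s) (sym (from∘to t))

  to⇄ : ∀ {s t} → s ⇄ t → from (to s) ⇄ from (to t)
  to⇄ {s} {t} = subst₂ _⇄_ (sym (from∘to s)) (sym (from∘to t))

  unique-on-Fin : ∀ {i j h} → from i ⇄ from h → from j ⇄ from h →
                  depth (from i) ℕ.< depth (from h) → depth (from j) ℕ.< depth (from h) → i ≡ j
  unique-on-Fin {i} {j} i⇄h j⇄h i< j< =
    trans (sym (to∘from i)) (trans (cong to (parent-unique i⇄h j⇄h i< j<)) (to∘from j))

  transport : {R : Rel Node 0ℓ} {S : Rel (Fin size) 0ℓ} →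
    (∀ {s t} → Star R s t → Star S (to s) (to t)) →
    ∀ {i j} → Star R (from i) (from j) → Star S i j
  transport f {i} {j} p = subst₂ (Star _) (to∘from i) (to∘from j) (f p)

  tree : Graph size
  tree = record
    { _∼_    = _⇄_ on from
    ; _∼?_   = λ i j → from i ⇄? from j
    ; sym-∼  = sym-⇄
    ; irrefl = λ { refl i⇄i → depth-≢ i⇄i refl }
    }

single : (G : Graph n) → ∀ {x} → (∀ {I} → IsIndependent G I → ⌜ ∣ I ∣ ⌝ ℚ.≤ x) → Decomposition G x
single G ≤x = record
  { Node          = Fin 1
  ; enumerate     = ↔-id _
  ; _⇄_           = λ _ _ → ⊥
  ; _⇄?_          = λ _ _ → no λ ()
  ; sym-⇄         = λ ()
  ; path          = λ { zero zero → ε }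
  ; root          = zero
  ; depth         = λ _ → 0
  ; depth-root    = refl
  ; depth-≢       = λ ()
  ; parent-unique = λ ()
  ; bag           = λ _ → ⊤
  ; vertexCover   = λ _ → zero , ∈⊤
  ; edgeCover     = λ _ → zero , ∈⊤ , ∈⊤
  ; connected     = λ { _ {zero} {zero} _ _ → ε }
  ; α≤            = λ _ _ → ≤x
  }

∈-image⁺ : ∀ (g : Fin m → Fin n) {J x} → x ∈ J → g x ∈ image g J
∈-image⁺ g {J} {x} x∈J = ∈-select⁺ (inImage? g J) (x , x∈J , refl)

∈-image⁻ : ∀ (g : Fin m → Fin n) {J u} → u ∈ image g J → ∃ λ x → x ∈ J × g x ≡ u
∈-image⁻ g {J} = ∈-select⁻ (inImage? g J)

module _ {𝒢 : GraphClass ℓ} {G : Graph n}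
  {𝒮 : List (Subset n)} (𝒮-cliques : All (IsClique G) 𝒮) where
  open Graph G

  extended-bag-α≤ : ∀ {S x}
    (H : Induced 𝒢 G S) (D : Decomposition (Induced.graph H) x) →
    ∀ t {I} → I ⊆ image (Induced.ι H) (Decomposition.bag D t) ∪ ⋃ 𝒮 → IsIndependent G I →
    ⌜ ∣ I ∣ ⌝ ℚ.≤ ⌜ length 𝒮 ⌝ ℚ.+ x
  extended-bag-α≤ {x = x} H D t {I} I⊆ I-ind = begin
    ⌜ ∣ I ∣ ⌝                              ≤⟨ ⌜⌝-mono-≤ (∣independent∣≤ G 𝒮 𝒮-cliques I-ind) ⟩
    ⌜ length 𝒮 ℕ.+ ∣ I′ ∣ ⌝                ≤⟨ ⌜⌝-mono-≤ (ℕ.+-monoʳ-≤ (length 𝒮)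
                                                (∣image∣≤ ι K I′⊆)) ⟩
    ⌜ length 𝒮 ℕ.+ ∣ K ∣ ⌝                 ≡⟨ ⌜⌝-+ (length 𝒮) ∣ K ∣ ⟩
    ⌜ length 𝒮 ⌝ ℚ.+ ⌜ ∣ K ∣ ⌝             ≤⟨ ℚ.+-monoʳ-≤ ⌜ length 𝒮 ⌝
                                                (Decomposition.α≤ D t K⊆bag K-ind) ⟩
    ⌜ length 𝒮 ⌝ ℚ.+ x                     ∎
    where
    open ℚ.≤-Reasoning
    open Induced H
    bag = Decomposition.bag D t
    I′  = I ─ ⋃ 𝒮
    I′⊆I = p─q⊆p I (⋃ 𝒮)
    -- Outside the separator, `I` lives entirely in the part, and its preimage `K` is independent
    -- there because `ι` preserves adjacency. So the bound on the old bag applies to `K`.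
    K   = preimage ι I′
    K⁻ : ∀ {y} → y ∈ K → ι y ∈ I′
    K⁻ = ∈-select⁻ (λ z → ι z ∈? I′)
    I′⊆bag : ∀ {u} → u ∈ I′ → ∃ λ y → y ∈ bag × ι y ≡ u
    I′⊆bag u∈ with x∈p∪q⁻ _ (⋃ 𝒮) (I⊆ (I′⊆I u∈))
    ... | inj₁ u∈im = ∈-image⁻ ι u∈im
    ... | inj₂ u∈⋃  = contradiction u∈⋃ (x∈p─q⇒x∉q I (⋃ 𝒮) u∈)
    I′⊆ : ∀ {u} → u ∈ I′ → ∃ λ y → y ∈ K × ι y ≡ u
    I′⊆ u∈ with I′⊆bag u∈
    ... | y , _ , refl = y , ∈-select⁺ (λ z → ι z ∈? I′) u∈ , refl
    K⊆bag : K ⊆ bag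
    K⊆bag y∈ = let z , z∈ , eq = I′⊆bag (K⁻ y∈) in subst (_∈ bag) (ι-injective eq) z∈
    K-ind : IsIndependent graph K
    K-ind y∈ z∈ y∼z = I-ind (I′⊆I (K⁻ y∈)) (I′⊆I (K⁻ z∈)) (ι-adjacent⁺ y∼z)

  glue : ∀ {A B x} → IsSeparation G A B → ⋃ 𝒮 ≡ A ∩ B →
    (H₁ : Induced 𝒢 G (A ─ B)) (H₂ : Induced 𝒢 G (B ─ A)) →
    Decomposition (Induced.graph H₁) x → Decomposition (Induced.graph H₂) x →
    Decomposition G (⌜ length 𝒮 ⌝ ℚ.+ x)
  glue {A} {B} {x} (A∪B≡⊤ , separated) ⋃≡∩ H₁ H₂ D₁ D₂ = record
    { Node          = Node
    ; enumerate     = ↔-sym +↔⊎ ↔-∘ (D₁.enumerate ⊎-↔ D₂.enumerate)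
    ; _⇄_           = _⇄_
    ; _⇄?_          = _⇄?_
    ; sym-⇄         = λ {s} {t} → sym-⇄ s t
    ; path          = path
    ; root          = inj₁ D₁.root
    ; depth         = depth
    ; depth-root    = D₁.depth-root
    ; depth-≢       = λ {s} {t} → depth-≢ s t
    ; parent-unique = λ {s} {t} {r} → parent-unique s t r
    ; bag           = bag
    ; vertexCover   = vertexCover
    ; edgeCover     = edgeCover
    ; connected     = connected
    ; α≤            = λ { (inj₁ s) → extended-bag-α≤ H₁ D₁ s ; (inj₂ t) → extended-bag-α≤ H₂ D₂ t }
    }
    where
    module H₁ = Induced H₁
    module H₂ = Induced H₂
    module D₁ = Decomposition D₁
    module D₂ = Decomposition D₂
    Node = D₁.Node ⊎ D₂.Node

    _⇄_ : Rel Node 0ℓ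
    inj₁ s ⇄ inj₁ t = s D₁.⇄ t
    inj₂ s ⇄ inj₂ t = s D₂.⇄ t
    inj₁ s ⇄ inj₂ t = s ≡ D₁.root × t ≡ D₂.root
    inj₂ s ⇄ inj₁ t = t ≡ D₁.root × s ≡ D₂.root

    _≟₁_ = inj⇒≟ (↔⇒↣ D₁.enumerate)
    _≟₂_ = inj⇒≟ (↔⇒↣ D₂.enumerate)

    _⇄?_ : Decidable _⇄_
    inj₁ s ⇄? inj₁ t = s D₁.⇄? t
    inj₂ s ⇄? inj₂ t = s D₂.⇄? t
    inj₁ s ⇄? inj₂ t = (s ≟₁ D₁.root) ×-dec (t ≟₂ D₂.root)
    inj₂ s ⇄? inj₁ t = (t ≟₁ D₁.root) ×-dec (s ≟₂ D₂.root)

    sym-⇄ : ∀ s t → s ⇄ t → t ⇄ s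
    sym-⇄ (inj₁ s) (inj₁ t) = D₁.sym-⇄
    sym-⇄ (inj₂ s) (inj₂ t) = D₂.sym-⇄
    sym-⇄ (inj₁ s) (inj₂ t) = id
    sym-⇄ (inj₂ s) (inj₁ t) = id

    path₁ : ∀ s t → Star _⇄_ (inj₁ s) (inj₁ t)
    path₁ s t = Star.gmap inj₁ id (D₁.path s t)

    path₂ : ∀ s t → Star _⇄_ (inj₂ s) (inj₂ t)
    path₂ s t = Star.gmap inj₂ id (D₂.path s t)

    path : ∀ s t → Star _⇄_ s t
    path (inj₁ s) (inj₁ t) = path₁ s t
    path (inj₂ s) (inj₂ t) = path₂ s t
    path (inj₁ s) (inj₂ t) = path₁ s D₁.root ◅◅ (refl , refl) ◅ path₂ D₂.root t
    path (inj₂ s) (inj₁ t) = path₂ s D₂.root ◅◅ (refl , refl) ◅ path₁ D₁.root t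

    -- The second root becomes a child of the first. Both roots have depth 0 in their own trees, so
    -- neither has a parent there, and the new edge is the only one leading down from the second
    -- root.
    depth : Node → ℕ
    depth (inj₁ s) = D₁.depth s
    depth (inj₂ t) = suc (D₂.depth t)

    depth-≢ : ∀ s t → s ⇄ t → depth s ≢ depth t
    depth-≢ (inj₁ s) (inj₁ t) s⇄t = D₁.depth-≢ s⇄t
    depth-≢ (inj₂ s) (inj₂ t) s⇄t = D₂.depth-≢ s⇄t ∘ ℕ.suc-injective
    depth-≢ (inj₁ s) (inj₂ t) (refl , refl) eq = ℕ.0≢1+n (trans (sym D₁.depth-root) eq)
    depth-≢ (inj₂ s) (inj₁ t) (refl , refl) eq = ℕ.0≢1+n (trans (sym D₁.depth-root) (sym eq))

    ≮root₁ : ∀ {k} → ¬ k ℕ.< D₁.depth D₁.root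
    ≮root₁ k< = ℕ.n≮0 (subst (_ ℕ.<_) D₁.depth-root k<)

    ≮root₂ : ∀ {k} → ¬ suc k ℕ.< suc (D₂.depth D₂.root)
    ≮root₂ k< = ℕ.n≮0 (subst (_ ℕ.<_) D₂.depth-root (ℕ.≤-pred k<))

    parent-unique : ∀ s t r → s ⇄ r → t ⇄ r → depth s ℕ.< depth r → depth t ℕ.< depth r → s ≡ t
    parent-unique (inj₁ s) (inj₁ t) (inj₁ r) s⇄r t⇄r s<r t<r =
      cong inj₁ (D₁.parent-unique s⇄r t⇄r s<r t<r)
    parent-unique (inj₁ s) (inj₁ t) (inj₂ r) (refl , _) (refl , _) _ _ = refl
    parent-unique (inj₂ s) (inj₂ t) (inj₂ r) s⇄r t⇄r s<r t<r =
      cong inj₂ (D₂.parent-unique s⇄r t⇄r (ℕ.≤-pred s<r) (ℕ.≤-pred t<r))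
    parent-unique (inj₂ s) t        (inj₁ r) (refl , _) _ s<r _ = contradiction s<r ≮root₁
    parent-unique s        (inj₂ t) (inj₁ r) _ (refl , _) _ t<r = contradiction t<r ≮root₁
    parent-unique (inj₁ s) (inj₂ t) (inj₂ r) (_ , refl) _ _ t<r = contradiction t<r ≮root₂
    parent-unique (inj₂ s) (inj₁ t) (inj₂ r) _ (_ , refl) s<r _ = contradiction s<r ≮root₂

    bag : Node → Subset n
    bag (inj₁ s) = image H₁.ι (D₁.bag s) ∪ ⋃ 𝒮
    bag (inj₂ t) = image H₂.ι (D₂.bag t) ∪ ⋃ 𝒮

    ∈bag₁ : ∀ {u s} → u ∈ D₁.bag s → H₁.ι u ∈ bag (inj₁ s)
    ∈bag₁ u∈ = x∈p∪q⁺ (inj₁ (∈-image⁺ H₁.ι u∈))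

    ∈bag₂ : ∀ {u t} → u ∈ D₂.bag t → H₂.ι u ∈ bag (inj₂ t)
    ∈bag₂ u∈ = x∈p∪q⁺ (inj₁ (∈-image⁺ H₂.ι u∈))

    ⋃⊆bag : ∀ {u} t → u ∈ ⋃ 𝒮 → u ∈ bag t
    ⋃⊆bag (inj₁ s) u∈ = x∈p∪q⁺ (inj₂ u∈)
    ⋃⊆bag (inj₂ t) u∈ = x∈p∪q⁺ (inj₂ u∈)

    data Side (u : Fin n) : Set where
      middle : u ∈ ⋃ 𝒮 → Side u
      left   : ∀ y → H₁.ι y ≡ u → Side u
      right  : ∀ y → H₂.ι y ≡ u → Side u

    side : ∀ u → Side u
    side u with u ∈? A | u ∈? B
    ... | yes u∈A | yes u∈B = middle (subst (u ∈_) (sym ⋃≡∩) (x∈p∩q⁺ (u∈A , u∈B)))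
    ... | yes u∈A | no  u∉B = let y , eq = H₁.ι-onto (x∈p∧x∉q⇒x∈p─q u∈A u∉B) in left y eq
    ... | no  u∉A | yes u∈B = let y , eq = H₂.ι-onto (x∈p∧x∉q⇒x∈p─q u∈B u∉A) in right y eq
    ... | no  u∉A | no  u∉B with x∈p∪q⁻ A B (subst (u ∈_) (sym A∪B≡⊤) ∈⊤)
    ...   | inj₁ u∈A = contradiction u∈A u∉A
    ...   | inj₂ u∈B = contradiction u∈B u∉B

    vertexCover : ∀ u → ∃ λ t → u ∈ bag t
    vertexCover u with side u
    ... | middle u∈     = inj₁ D₁.root , ⋃⊆bag (inj₁ D₁.root) u∈
    ... | left y refl  = let t , y∈ = D₁.vertexCover y in inj₁ t , ∈bag₁ y∈
    ... | right y refl = let t , y∈ = D₂.vertexCover y in inj₂ t , ∈bag₂ y∈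

    edgeCover : ∀ {u v} → u ∼ v → ∃ λ t → u ∈ bag t × v ∈ bag t
    edgeCover {u} {v} u∼v with side u | side v
    ... | middle u∈    | _ = let t , v∈ = vertexCover v in t , ⋃⊆bag t u∈ , v∈
    ... | _            | middle v∈ = let t , u∈ = vertexCover u in t , u∈ , ⋃⊆bag t v∈
    ... | left y refl  | left z refl =
      let t , y∈ , z∈ = D₁.edgeCover (H₁.ι-adjacent⁻ u∼v) in inj₁ t , ∈bag₁ y∈ , ∈bag₁ z∈
    ... | right y refl | right z refl =
      let t , y∈ , z∈ = D₂.edgeCover (H₂.ι-adjacent⁻ u∼v) in inj₂ t , ∈bag₂ y∈ , ∈bag₂ z∈
    ... | left y refl  | right z refl = contradiction u∼v (separated (H₁.ι-∈ y) (H₂.ι-∈ z))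
    ... | right y refl | left z refl  = contradiction (sym-∼ u∼v) (separated (H₁.ι-∈ z) (H₂.ι-∈ y))

    connected : ∀ u {s t} → u ∈ bag s → u ∈ bag t →
                Star (λ s′ t′ → s′ ⇄ t′ × u ∈ bag s′ × u ∈ bag t′) s t
    -- A separator vertex is in every bag, so any path will do. Any other vertex belongs to one side
    -- only, and its path is inherited from that side.
    connected u {s} {t} u∈s u∈t with u ∈? ⋃ 𝒮
    ... | yes u∈ = Star.map (λ {s′} {t′} s⇄t → s⇄t , ⋃⊆bag s′ u∈ , ⋃⊆bag t′ u∈) (path s t)
    ... | no u∉  = go s t (outside⋃ s u∈s) (outside⋃ t u∈t)
      where
      InPart : Node → Set
      InPart (inj₁ s) = ∃ λ y → y ∈ D₁.bag s × H₁.ι y ≡ u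
      InPart (inj₂ t) = ∃ λ y → y ∈ D₂.bag t × H₂.ι y ≡ u

      outside⋃ : ∀ t → u ∈ bag t → InPart t
      outside⋃ (inj₁ s) u∈ = [ ∈-image⁻ H₁.ι , (λ u∈⋃ → contradiction u∈⋃ u∉) ]′ (x∈p∪q⁻ _ (⋃ 𝒮) u∈)
      outside⋃ (inj₂ t) u∈ = [ ∈-image⁻ H₂.ι , (λ u∈⋃ → contradiction u∈⋃ u∉) ]′ (x∈p∪q⁻ _ (⋃ 𝒮) u∈)

      disjoint : ∀ {y z} → H₁.ι y ≡ u → H₂.ι z ≡ u → ⊥
      disjoint {y} {z} refl eq =
        x∈p─q⇒x∉q A B (H₁.ι-∈ y) (p─q⊆p B A (subst (_∈ B ─ A) eq (H₂.ι-∈ z)))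

      go : ∀ s t → InPart s → InPart t → Star (λ s′ t′ → s′ ⇄ t′ × u ∈ bag s′ × u ∈ bag t′) s t
      go (inj₁ s) (inj₁ t) (y , y∈s , refl) (z , z∈t , eq) with H₁.ι-injective eq
      ... | refl = Star.gmap inj₁ (λ (s⇄t , y∈ , y∈′) → s⇄t , ∈bag₁ y∈ , ∈bag₁ y∈′)
                       (D₁.connected y y∈s z∈t)
      go (inj₂ s) (inj₂ t) (y , y∈s , refl) (z , z∈t , eq) with H₂.ι-injective eq
      ... | refl = Star.gmap inj₂ (λ (s⇄t , y∈ , y∈′) → s⇄t , ∈bag₂ y∈ , ∈bag₂ y∈′)
                       (D₂.connected y y∈s z∈t)
      go (inj₁ s) (inj₂ t) (y , _ , eq) (z , _ , eq′) = contradiction eq′ (disjoint eq)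
      go (inj₂ s) (inj₁ t) (y , _ , eq) (z , _ , eq′) = contradiction eq (disjoint eq′)

-- Products of reals

below≤above : ∀ x {p q} → Below x p → ¬ Below x q → p ℚ.≤ q
below≤above x x>p x≤q = ℚ.≮⇒≥ λ q<p → x≤q (ℝ.downward x (ℚ.<⇒≤ q<p) x>p)

0≤above : ∀ {y q} → 0ℝ ≤ y → ¬ Below y q → 0ℚ ℚ.≤ q
0≤above 0≤y y≤q = ℚ.≮⇒≥ λ q<0 → y≤q (0≤y q<0)

-- The factor `x` may have either sign, as the constants C and c may. The products with the lower
-- end `a` of its interval suffice: if `c` is nonnegative, then ac ≤ qr; otherwise c ≤ 0 ≤ d, and
-- one of ac, ad is at most 0 ≤ qr.
·-above : ∀ x y {q r} → 0ℝ ≤ y → 0ℚ ℚ.≤ q → ¬ Below x q → ¬ Below y r → ¬ Below (x · y) (q * r)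
·-above x y {q} {r} 0≤y 0≤q x≤q y≤r xy>qr = xy>qr
  λ { (s , (a , b , c , d , (x>a , _) , (y>c , y≤d) , s≤ac , s≤ad , _) , qr<s) →
      <⇒≱ qr<s (bound s a c d (below≤above x x>a x≤q) (below≤above y y>c y≤r)
                      (0≤above {y} 0≤y y≤d) s≤ac s≤ad) }
  where
  0≤r : 0ℚ ℚ.≤ r
  0≤r = 0≤above {y} 0≤y y≤r
  nonpos : ∀ a c d {s} → c ℚ.≤ 0ℚ → 0ℚ ℚ.≤ d → s ℚ.≤ a * c → s ℚ.≤ a * d → s ℚ.≤ 0ℚ
  nonpos a c d c≤0 0≤d s≤ac s≤ad with ℚ.≤-total 0ℚ a
  ... | inj₁ 0≤a = ℚ.≤-trans s≤ac (subst (a * c ℚ.≤_) (ℚ.*-zeroʳ a) (*-monoˡ 0≤a c≤0))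
  ... | inj₂ a≤0 = ℚ.≤-trans s≤ad (subst (a * d ℚ.≤_) (ℚ.*-zeroˡ d) (*-monoʳ 0≤d a≤0))
  bound : ∀ s a c d → a ℚ.≤ q → c ℚ.≤ r → 0ℚ ℚ.≤ d → s ℚ.≤ a * c → s ℚ.≤ a * d → s ℚ.≤ q * r
  bound s a c d a≤q c≤r 0≤d s≤ac s≤ad with ℚ.≤-total 0ℚ c
  ... | inj₁ 0≤c = ℚ.≤-trans s≤ac (ℚ.≤-trans (*-monoʳ 0≤c a≤q) (*-monoˡ 0≤q c≤r))
  ... | inj₂ c≤0 = ℚ.≤-trans (nonpos a c d c≤0 0≤d s≤ac s≤ad) (*-nonneg 0≤q 0≤r)

≤·⇒≤* : ∀ x y {p q r} → 0ℝ ≤ y → 0ℚ ℚ.≤ q → ¬ Below x q → ¬ Below y r →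
        fromℚ p ≤ x · y → p ℚ.≤ q * r
≤·⇒≤* x y 0≤y 0≤q x≤q y≤r p≤xy = ℚ.≮⇒≥ λ qr<p → ·-above x y 0≤y 0≤q x≤q y≤r (p≤xy qr<p)

·-below : ∀ x y {a c r} → 0ℚ ℚ.≤ a → 0ℚ ℚ.≤ c → Below x a → Below y c →
          r ℚ.< a * c → Below (x · y) r
·-below x y {a} {c} 0≤a 0≤c x>a y>c r<ac ¬∃ =
  let b , x≤b = ℝ.bounded x
      d , y≤d = ℝ.bounded y
      a≤b = below≤above x x>a x≤b
      c≤d = below≤above y y>c y≤d
      ac≤ad = *-monoˡ 0≤a c≤d
  in ¬∃ (a * c , (a , b , c , d , (x>a , x≤b) , (y>c , y≤d) ,
         ℚ.≤-refl , ac≤ad , *-monoʳ 0≤c a≤b ,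
         ℚ.≤-trans ac≤ad (*-monoʳ (ℚ.≤-trans 0≤c c≤d) a≤b)) , r<ac)

-- Given r < 0, the intervals around `x` and `y` start at a slightly negative `a`, chosen so that
-- even its product with `D`, a common bound of both upper ends, stays above `r`. The summand 1
-- keeps `D` positive when both ends are 0.
0≤· : ∀ x y → 0ℝ ≤ x → 0ℝ ≤ y → 0ℝ ≤ x · y
0≤· x y 0≤x 0≤y {r} r<0 ¬∃ =
  let b , x≤b = ℝ.bounded x
      d , y≤d = ℝ.bounded y
      0≤b = 0≤above {x} 0≤x x≤b
      0≤d = 0≤above {y} 0≤y y≤d
      D = 1ℚ + (b + d)
      b≤D : b ℚ.≤ D
      b≤D = subst (ℚ._≤ D) (trans (ℚ.+-identityˡ _) (ℚ.+-identityʳ b))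
              (ℚ.+-mono-≤ {0ℚ} {1ℚ} (ℚ.nonNegative⁻¹ 1ℚ) (ℚ.+-monoʳ-≤ b 0≤d))
      d≤D : d ℚ.≤ D
      d≤D = subst (ℚ._≤ D) (trans (ℚ.+-identityˡ _) (ℚ.+-identityˡ d))
              (ℚ.+-mono-≤ {0ℚ} {1ℚ} (ℚ.nonNegative⁻¹ 1ℚ) (ℚ.+-monoˡ-≤ d 0≤b))
      0<D : 0ℚ ℚ.< D
      0<D = ℚ.<-≤-trans (ℚ.positive⁻¹ 1ℚ)
              (subst (ℚ._≤ D) (ℚ.+-identityʳ 1ℚ) (ℚ.+-monoʳ-≤ 1ℚ
                (subst (ℚ._≤ b + d) (ℚ.+-identityʳ 0ℚ) (ℚ.+-mono-≤ 0≤b 0≤d))))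
      s , r<s , s<0 = ℚ.<-dense r<0
      a , Da≡s = divide s 0<D
      a<0 = divide-sign 0<D (subst (ℚ._< 0ℚ) (sym Da≡s) s<0)
      a≤0 = ℚ.<⇒≤ a<0
      s≤0 = ℚ.<⇒≤ s<0
      0≤aa : 0ℚ ℚ.≤ a * a
      0≤aa = subst (ℚ._≤ a * a) (ℚ.*-zeroʳ a) (ℚ.*-monoˡ-≤-nonPos a {{ℚ.nonPositive a≤0}} a≤0)
      s≤at : ∀ {t} → t ℚ.≤ D → s ℚ.≤ t * a
      s≤at = λ {t} t≤D → subst (ℚ._≤ t * a) Da≡s (ℚ.*-monoʳ-≤-nonPos a {{ℚ.nonPositive a≤0}} t≤D)
  in ¬∃ (s , (a , b , a , d , (0≤x a<0 , x≤b) , (0≤y a<0 , y≤d) ,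
         ℚ.≤-trans s≤0 0≤aa ,
         subst (s ℚ.≤_) (ℚ.*-comm d a) (s≤at d≤D) ,
         s≤at b≤D ,
         ℚ.≤-trans s≤0 (*-nonneg 0≤b 0≤d)) , r<s)

·-comm : ∀ x y → x · y ≤ y · x
·-comm x y xy>r ¬∃ = xy>r λ
  { (s , (a , b , c , d , x∈ , y∈ , s≤ac , s≤ad , s≤bc , s≤bd) , r<s) →
    ¬∃ (s , (c , d , a , b , y∈ , x∈ ,
             sw a c s≤ac , sw b c s≤bc , sw a d s≤ad , sw b d s≤bd) , r<s) }
  where
  sw : ∀ {s} p q → s ℚ.≤ p * q → s ℚ.≤ q * p
  sw {s} p q = subst (s ℚ.≤_) (ℚ.*-comm p q)

·-scale : ∀ x y {e q} → 0ℚ ℚ.< e → fromℚ e ≤ x → 0ℝ ≤ y → Below y q → Below (x · y) (e * q)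
·-scale x y {e} {q} 0<e e≤x 0≤y y>q with 0ℚ ℚ.≤? q
-- Neither `e` nor `q` itself may serve as an interval end, since cuts are strict. Roundedness moves
-- `q` up to `c`, and the room between eq and ec allows a factor `a` < `e` with eq < ac.
... | yes 0≤q = ℝ.stable (x · y) λ ¬below → ℝ.rounded y y>q λ (c , q<c , y>c) →
  let 0<c           = ℚ.≤-<-trans 0≤q q<c
      t , eq<t , t<ec = ℚ.<-dense (ℚ.*-monoʳ-<-pos e {{ℚ.positive 0<e}} q<c)
      a , ca≡t      = divide t 0<c
      ac≡t          = trans (ℚ.*-comm a c) ca≡t
      0≤t           = ℚ.≤-trans (*-nonneg (ℚ.<⇒≤ 0<e) 0≤q) (ℚ.<⇒≤ eq<t)
      a<e           = ℚ.*-cancelʳ-<-nonNeg c {{ℚ.nonNegative (ℚ.<⇒≤ 0<c)}} {a} {e}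
                        (subst (ℚ._< e * c) (sym ac≡t) t<ec)
      0≤a           = ℚ.≮⇒≥ λ a<0 → <⇒≱ (subst₂ ℚ._<_ ac≡t (ℚ.*-zeroˡ c)
                        (ℚ.*-monoˡ-<-pos c {{ℚ.positive 0<c}} {a} {0ℚ} a<0)) 0≤t
  in ¬below (·-below x y 0≤a (ℚ.<⇒≤ 0<c) (e≤x a<e) y>c (subst (e * q ℚ.<_) (sym ac≡t) eq<t))
... | no  0≰q = 0≤· x y (λ r<0 → e≤x (ℚ.<-trans r<0 0<e)) 0≤y
  (subst (e * q ℚ.<_) (ℚ.*-zeroʳ e) (ℚ.*-monoʳ-<-pos e {{ℚ.positive 0<e}} (ℚ.≰⇒> 0≰q)))

-- This turns rational bounds into a real inequality. Any s < p has the form K r; if `r` were an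
-- upper bound of `y`, then p ≤ K r = s, so `r` is below `y` by stability.
≤fromℚ· : ∀ y {p K} → 0ℚ ℚ.< K → 0ℝ ≤ y → (∀ r → ¬ Below y r → p ℚ.≤ K * r) → fromℚ p ≤ fromℚ K · y
≤fromℚ· y {p} {K} 0<K 0≤y bound {s} s<p =
  let r , Kr≡s = divide s 0<K
  in subst (Below (fromℚ K · y)) Kr≡s (·-scale (fromℚ K) y 0<K id 0≤y
       (ℝ.stable y λ y≤r → <⇒≱ s<p (subst (p ℚ.≤_) Kr≡s (bound r y≤r))))

-- m and n are explicit because unification cannot recover them from fromℕ m
-- and fromℕ n, which unfold to cuts.
fromℕ-mono-≤ : ∀ m n → m ℕ.≤ n → fromℕ m ≤ fromℕ n
fromℕ-mono-≤ m n m≤n q<m = ℚ.<-≤-trans q<m (⌜⌝-mono-≤ m≤n)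

≤fromℕ : ∀ n → ¬ Below (fromℕ n) ⌜ n ⌝
≤fromℕ n = ℚ.<-irrefl refl

0≤fromℕ : ∀ n → 0ℝ ≤ fromℕ n
0≤fromℕ n = fromℕ-mono-≤ 0 n ℕ.z≤n

-- Extrema up to double negation

¬¬-maximum : (P : ℕ → Set ℓ) (b : ℕ) → (∀ {k} → P k → k ℕ.≤ b) → ∃ P → ¬ ¬ ∃ (IsMaximum P)
¬¬-maximum P b ≤b (k , Pk) ¬max = none (suc b ℕ.∸ k) k ℕ.≤-refl Pk
  where
  none : ∀ d k → suc b ℕ.∸ k ℕ.≤ d → ¬ P k
  none zero    k le Pk = ℕ.<⇒≱ (ℕ.s≤s (≤b Pk)) (ℕ.m∸n≡0⇒m≤n (ℕ.n≤0⇒n≡0 le))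
  none (suc d) k le Pk = ¬max (k , Pk , λ {i} Pi → ℕ.≮⇒≥ λ k<i →
    none d i (ℕ.≤-pred (ℕ.<-≤-trans (ℕ.∸-monoʳ-< k<i (ℕ.m≤n⇒m≤1+n (≤b Pi))) le)) Pi)

-- The floor is the largest natural number below `x`: if no rational separated `x` from m+1, then
-- m+1 ≤ x would contradict maximality. Maximality is also returned, to compare the floor with the
-- order of a part.
¬¬-floor : ∀ x b → 0ℝ ≤ x → (∀ {k} → fromℕ k ≤ x → k ℕ.≤ b) →
           ¬ ¬ ∃ λ m → IsFloor x m × (∀ {k} → fromℕ k ≤ x → k ℕ.≤ m)
¬¬-floor x b 0≤x ≤b ¬floor =
  ¬¬-maximum (λ k → fromℕ k ≤ x) b ≤b (0 , 0≤x) λ (m , m≤x , max) →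
    ℕ.1+n≰n (max {suc m} λ {q} q<1+m →
      ℝ.stable x λ x≤q → ¬floor (m , (m≤x , q , x≤q , q<1+m) , max))

-- Minimality of `k` applies only to an exact independence number of the decomposition, not to an
-- upper bound. That number exists up to double negation, which suffices because `≤` on rationals is
-- decidable.
tree-independence≤ : ∀ {G : Graph n} {k x} → IsTreeIndependenceNumber G k →
                     Decomposition G x → ⌜ k ⌝ ℚ.≤ x
tree-independence≤ {n} {G} {k} {x} (_ , k≤) D = decidable-stable (⌜ k ⌝ ℚ.≤? x) λ k≰x →
  ¬¬-α (bag t₀) λ α₀ →
  ¬¬-maximum (λ k → ∃ λ t → IsIndependenceNumberOn G (bag t) k) n
    (λ { (t , (I , _ , _ , refl) , _) → ∣p∣≤n I }) (proj₁ α₀ , t₀ , proj₂ α₀)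
    λ { (j , max@((t , (I , I⊆ , I-ind , refl) , _) , _)) →
        k≰x (ℚ.≤-trans (⌜⌝-mono-≤ (k≤ (𝒯 , max))) (α≤ t I⊆ I-ind)) }
  where
  𝒯 = proj₁ (toTreeDecomposition D)
  α≤ = proj₂ (toTreeDecomposition D)
  open TreeDecomposition 𝒯 using (bag)
  t₀ = Inverse.to (Decomposition.enumerate D) (Decomposition.root D)
  ¬¬-α : ∀ X → ¬ ¬ ∃ (IsIndependenceNumberOn G X)
  ¬¬-α X = ¬¬-maximum (λ k → ∃ λ I → I ⊆ X × IsIndependent G I × ∣ I ∣ ≡ k) n
    (λ { (I , _ , _ , refl) → ∣p∣≤n I })
    (0 , Subset.⊥ , ⊥⊆ , (λ u∈⊥ → contradiction u∈⊥ ∉⊥) , ∣⊥∣≡0 n)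

-- Rational contraction factors

ratio : ℕ → ℚ
ratio k = + k ℚ./ suc k

toℚᵘ-ratio : ∀ k → ℚ.toℚᵘ (ratio k) ℚᵘ.≃ ℚᵘ.mkℚᵘ (+ k) k
toℚᵘ-ratio k = ℚ.toℚᵘ-fromℚᵘ (ℚᵘ.mkℚᵘ (+ k) k)

*-ratio : ∀ k → ⌜ suc k ⌝ * ratio k ≡ ⌜ k ⌝
*-ratio k = ℚ.toℚᵘ-injective (ℚᵘ.≃-trans (ℚ.toℚᵘ-homo-* ⌜ suc k ⌝ (ratio k))
  (ℚᵘ.≃-trans (ℚᵘ.*-cong (toℚᵘ-⌜⌝ (suc k)) (toℚᵘ-ratio k))
  (ℚᵘ.≃-trans (ℚᵘ.*≡* (trans (ℤ.*-identityʳ _)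
    (trans (ℤ.*-comm (+ suc k) (+ k)) (cong (λ j → + k ℤ.* + suc j) (sym (ℕ.+-identityʳ k))))))
  (ℚᵘ.≃-sym (toℚᵘ-⌜⌝ k)))))

0≤ratio : ∀ k → 0ℚ ℚ.≤ ratio k
0≤ratio k = ℚ.nonNegative⁻¹ (ratio k) {{ℚ.normalize-nonNeg k (suc k)}}

-- With k the denominator, q ≤ (k-1)/k ≤ k/(k+1). Taking the denominator rather than its predecessor
-- keeps k nonzero, as the halving estimate requires.
<1⇒≤ratio : ∀ q → q ℚ.< 1ℚ → q ℚ.≤ ratio (ℚ.↧ₙ q)
<1⇒≤ratio q@(mkℚ num d _) q<1 = ℚ.toℚᵘ-cancel-≤
  (ℚᵘ.≤-respʳ-≃ (ℚᵘ.≃-sym (toℚᵘ-ratio (suc d))) (ℚᵘ.*≤* (cross num num<)))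
  where
  num< : num ℤ.< + suc d
  num< = subst₂ ℤ._<_ (ℤ.*-identityʳ num) (ℤ.*-identityˡ (+ suc d)) (ℚ.drop-*<* q<1)
  cross : ∀ i → i ℤ.< + suc d → i ℤ.* + suc (suc d) ℤ.≤ + suc d ℤ.* + suc d
  cross -[1+ a ] _               = ℤ.-≤+
  cross (+ a)    (ℤ.+<+ a<1+d)   =
    subst (ℤ._≤ + suc d ℤ.* + suc d) (ℤ.pos-* a (suc (suc d))) (ℤ.+≤+ (begin
      a ℕ.* suc (suc d)       ≤⟨ ℕ.*-monoˡ-≤ (suc (suc d)) (ℕ.≤-pred a<1+d) ⟩
      d ℕ.* suc (suc d)       ≡⟨ ℕ.*-suc d (suc d) ⟩
      d ℕ.+ d ℕ.* suc d       ≤⟨ ℕ.+-monoˡ-≤ _ (ℕ.n≤1+n d) ⟩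
      suc d ℕ.* suc d         ∎))
    where open ℕ.≤-Reasoning

<1⇒ratio-above : ∀ x → x < 1ℝ → ∃ λ k → NonZero k × ¬ Below x (ratio k)
<1⇒ratio-above x (q , x≤q , q<1) =
  ℚ.↧ₙ q , _ , λ x>ratio → x≤q (ℝ.downward x (<1⇒≤ratio q q<1) x>ratio)

-- The number of levels

bernoulli : ∀ k m → k ℕ.^ m ℕ.* (k ℕ.+ m) ℕ.≤ suc k ℕ.^ m ℕ.* k
bernoulli k zero    = ℕ.≤-reflexive (cong (1 ℕ.*_) (ℕ.+-identityʳ k))
bernoulli k (suc m) = begin
  -- The claim is (1 + 1/k)^m ≥ 1 + m/k with denominators cleared. The added slack completes
  -- k(k+m+1) + m = (k+1)(k+m).
  k ℕ.* k ℕ.^ m ℕ.* (k ℕ.+ suc m)                ≤⟨ ℕ.m≤m+n _ (k ℕ.^ m ℕ.* m) ⟩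
  k ℕ.* k ℕ.^ m ℕ.* (k ℕ.+ suc m) ℕ.+ k ℕ.^ m ℕ.* m  ≡⟨ rearrange k m (k ℕ.^ m) ⟩
  suc k ℕ.* (k ℕ.^ m ℕ.* (k ℕ.+ m))              ≤⟨ ℕ.*-monoʳ-≤ (suc k) (bernoulli k m) ⟩
  suc k ℕ.* (suc k ℕ.^ m ℕ.* k)                  ≡⟨ ℕ.*-assoc (suc k) (suc k ℕ.^ m) k ⟨
  suc k ℕ.^ suc m ℕ.* k                          ∎
  where
  open ℕ.≤-Reasoning
  rearrange : ∀ k m p → k ℕ.* p ℕ.* (k ℕ.+ suc m) ℕ.+ p ℕ.* m ≡ suc k ℕ.* (p ℕ.* (k ℕ.+ m))
  rearrange = solve-∀

-- That is, (k/(k+1))^k ≤ 1/2: a factor k/(k+1) applied k times at least halves.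
2*k^k≤[1+k]^k : ∀ k .{{_ : NonZero k}} → 2 ℕ.* k ℕ.^ k ℕ.≤ suc k ℕ.^ k
2*k^k≤[1+k]^k k = ℕ.*-cancelʳ-≤ _ _ k
  (ℕ.≤-trans (ℕ.≤-reflexive (rearrange k (k ℕ.^ k))) (bernoulli k k))
  where
  rearrange : ∀ k p → 2 ℕ.* p ℕ.* k ≡ p ℕ.* (k ℕ.+ k)
  rearrange = solve-∀

*≤⇒^*^≤^ : ∀ {a b c} e → a ℕ.* b ℕ.≤ c → a ℕ.^ e ℕ.* b ℕ.^ e ℕ.≤ c ℕ.^ e
*≤⇒^*^≤^             zero    ab≤c = ℕ.≤-refl
*≤⇒^*^≤^ {a} {b} {c} (suc e) ab≤c = begin
  a ℕ.* a ℕ.^ e ℕ.* (b ℕ.* b ℕ.^ e)  ≡⟨ ℕ.[m*n]*[o*p]≡[m*o]*[n*p] a (a ℕ.^ e) b (b ℕ.^ e) ⟩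
  a ℕ.* b ℕ.* (a ℕ.^ e ℕ.* b ℕ.^ e)  ≤⟨ ℕ.*-mono-≤ ab≤c (*≤⇒^*^≤^ e ab≤c) ⟩
  c ℕ.* c ℕ.^ e                      ∎
  where open ℕ.≤-Reasoning

-- Every `k` levels halve the size, so k·e levels bring anything below 2^e down to less than one
-- vertex.
n*k^j<[1+k]^j : ∀ {n} k e .{{_ : NonZero k}} → n ℕ.< 2 ℕ.^ e →
                n ℕ.* k ℕ.^ (k ℕ.* e) ℕ.< suc k ℕ.^ (k ℕ.* e)
n*k^j<[1+k]^j {n} k e n<2^e = begin-strict
  n ℕ.* k ℕ.^ (k ℕ.* e)            <⟨ ℕ.*-monoˡ-< (k ℕ.^ (k ℕ.* e)) {{ℕ.m^n≢0 k (k ℕ.* e)}} n<2^e ⟩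
  2 ℕ.^ e ℕ.* k ℕ.^ (k ℕ.* e)      ≡⟨ cong (2 ℕ.^ e ℕ.*_) (ℕ.^-*-assoc k k e) ⟨
  2 ℕ.^ e ℕ.* (k ℕ.^ k) ℕ.^ e      ≤⟨ *≤⇒^*^≤^ e (2*k^k≤[1+k]^k k) ⟩
  (suc k ℕ.^ k) ℕ.^ e              ≡⟨ ℕ.^-*-assoc (suc k) k e ⟩
  suc k ℕ.^ (k ℕ.* e)              ∎
  where open ℕ.≤-Reasoning

dyadic : ∀ n .{{_ : NonZero n}} → ∃ λ e → 2 ℕ.^ e ℕ.≤ n × n ℕ.< 2 ℕ.^ suc e
dyadic 1             = 0 , ℕ.≤-refl , ℕ.≤-refl
dyadic (suc n@(suc _)) with dyadic n
... | e , 2^e≤n , n<2^1+e with ℕ.m≤n⇒m<n∨m≡n n<2^1+e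
...   | inj₁ 1+n<2^1+e = e , ℕ.m≤n⇒m≤1+n 2^e≤n , 1+n<2^1+e
...   | inj₂ 1+n≡2^1+e = suc e , ℕ.≤-reflexive (sym 1+n≡2^1+e) ,
  subst (ℕ._< 2 ℕ.^ suc (suc e)) (sym 1+n≡2^1+e)
    (ℕ.^-monoʳ-< 2 (ℕ.s≤s (ℕ.s≤s ℕ.z≤n)) (ℕ.n<1+n (suc e)))

≤log₂ : ∀ {n e} .{{_ : NonZero n}} → 2 ℕ.^ e ℕ.≤ n → fromℕ e ≤ log₂ n
≤log₂ {n} {e} 2^e≤n q<e ¬∃ =
  ¬∃ (⌜ e ⌝ , (e , 0 , refl , ℕ.≤-trans 2^e≤n (ℕ.≤-reflexive (sym (ℕ.^-identityʳ n)))) , q<e)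

0<⌜⌝ : ∀ n .{{_ : NonZero n}} → 0ℚ ℚ.< ⌜ n ⌝
0<⌜⌝ n = ℚ.positive⁻¹ ⌜ n ⌝ {{ℚ.normalize-pos n 1}}

*-pos : ∀ {p q} → 0ℚ ℚ.< p → 0ℚ ℚ.< q → 0ℚ ℚ.< p * q
*-pos {p} {q} 0<p 0<q =
  ℚ.positive⁻¹ (p * q) {{ℚ.pos*pos⇒pos p {{ℚ.positive 0<p}} q {{ℚ.positive 0<q}}}}

*-interchange : ∀ a b c d → a * b * (c * d) ≡ a * c * (b * d)
*-interchange = solve 4 (λ a b c d → a :* b :* (c :* d) := a :* c :* (b :* d)) refl
  where open ℚSolver.+-*-Solver

≤-nonZero : m ℕ.≤ n → .{{NonZero m}} → NonZero n
≤-nonZero {suc m} (ℕ.s≤s _) = _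

-- Costs summed over the levels

⌜suc⌝* : ∀ j x → ⌜ suc j ⌝ * x ≡ x + ⌜ j ⌝ * x
⌜suc⌝* j x = begin
  ⌜ suc j ⌝ * x       ≡⟨ cong (_* x) (⌜⌝-+ 1 j) ⟩
  (1ℚ + ⌜ j ⌝) * x    ≡⟨ ℚ.*-distribʳ-+ x 1ℚ ⌜ j ⌝ ⟩
  1ℚ * x + ⌜ j ⌝ * x  ≡⟨ cong (_+ ⌜ j ⌝ * x) (ℚ.*-identityˡ x) ⟩
  x + ⌜ j ⌝ * x       ∎
  where open ≡-Reasoning

≤⌜suc⌝* : ∀ j {x} → 0ℚ ℚ.≤ x → x ℚ.≤ ⌜ suc j ⌝ * x
≤⌜suc⌝* j {x} 0≤x = begin
  x                  ≡⟨ ℚ.+-identityʳ x ⟨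
  x + 0ℚ             ≤⟨ ℚ.+-monoʳ-≤ x (*-nonneg (0≤⌜⌝ j) 0≤x) ⟩
  x + ⌜ j ⌝ * x      ≡⟨ ⌜suc⌝* j x ⟨
  ⌜ suc j ⌝ * x      ∎
  where open ℚ.≤-Reasoning

levels≤ : ∀ l J {K r} → 0ℚ ℚ.≤ K → 0ℚ ℚ.≤ r →
          ⌜ J ⌝ * (K * r) ℚ.≤ ⌜ suc l ⌝ * (⌜ suc J ⌝ * K * r)
levels≤ l J {K} {r} 0≤K 0≤r = begin
  ⌜ J ⌝ * (K * r)                    ≤⟨ *-monoʳ 0≤Kr (⌜⌝-mono-≤ (ℕ.n≤1+n J)) ⟩
  ⌜ suc J ⌝ * (K * r)                ≤⟨ ≤⌜suc⌝* l (*-nonneg (0≤⌜⌝ (suc J)) 0≤Kr) ⟩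
  ⌜ suc l ⌝ * (⌜ suc J ⌝ * (K * r))  ≡⟨ cong (⌜ suc l ⌝ *_) (ℚ.*-assoc ⌜ suc J ⌝ K r) ⟨
  ⌜ suc l ⌝ * (⌜ suc J ⌝ * K * r)    ∎
  where
  open ℚ.≤-Reasoning
  0≤Kr = *-nonneg 0≤K 0≤r

-- The factor l+1 is the sum 1/(1 - l/(l+1)) of the series, the solution of S = 1 + S·l/(l+1). A
-- separate `K′` above `K` leaves room for the cost of the base case.
geometric-step : ∀ l {K K′ r} → K ℚ.≤ K′ → 0ℚ ℚ.≤ r →
                 K * r + ⌜ suc l ⌝ * (K′ * (ratio l * r)) ℚ.≤ ⌜ suc l ⌝ * (K′ * r)
geometric-step l {K} {K′} {r} K≤K′ 0≤r = begin
  K * r + ⌜ suc l ⌝ * (K′ * (ratio l * r))  ≡⟨ cong (λ p → K * r + p)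
                                                   (rearrange ⌜ suc l ⌝ K′ (ratio l) r) ⟩
  K * r + ⌜ suc l ⌝ * ratio l * (K′ * r)    ≡⟨ cong (λ p → K * r + p * (K′ * r)) (*-ratio l) ⟩
  K * r + ⌜ l ⌝ * (K′ * r)                  ≤⟨ ℚ.+-monoˡ-≤ (⌜ l ⌝ * (K′ * r)) (*-monoʳ 0≤r K≤K′) ⟩
  K′ * r + ⌜ l ⌝ * (K′ * r)                 ≡⟨ ⌜suc⌝* l (K′ * r) ⟨
  ⌜ suc l ⌝ * (K′ * r)                      ∎
  where
  open ℚ.≤-Reasoning
  rearrange : ∀ a b c d → a * (b * (c * d)) ≡ a * c * (b * d)
  rearrange = solve 4 (λ a b c d → a :* (b :* (c :* d)) := a :* c :* (b :* d)) refl
    where open ℚSolver.+-*-Solver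

-- Vacuous for n = 0, where f ⟨ n ⟩ is not defined.
infix 4 _Bounds_at_
_Bounds_at_ : ℚ → (ℝ>0 → ℝ≥0) → ℕ → Set
r Bounds f at n = .{{_ : NonZero n}} → ¬ Below (f ⟨ n ⟩) r

-- Recursion along separators

Member : GraphClass ℓ → Graph n → Set ℓ
Member {n = n} 𝒢 G = .{{_ : NonZero n}} → 𝒢 G

-- The orders are bounded by the real βn and not yet by the integer inequality, because the
-- contraction hypothesis speaks of ⌊βn⌋ itself.
record Split (β : ℝ) (𝒢 : GraphClass ℓ) (G : Graph n) (s : ℚ) : Set (lsuc 0ℓ ⊔ ℓ) where
  field
    {S₁ S₂} : Subset n
    part₁   : Induced 𝒢 G S₁
    part₂   : Induced 𝒢 G S₂
    light₁  : fromℕ (Induced.order part₁) ≤ β · fromℕ n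
    light₂  : fromℕ (Induced.order part₂) ≤ β · fromℕ n
    rejoin  : ∀ {x} → Decomposition (Induced.graph part₁) x →
              Decomposition (Induced.graph part₂) x → Decomposition G (s + x)

decompose-empty : (G : Graph 0) → ∀ {x} → 0ℚ ℚ.≤ x → Decomposition G x
decompose-empty G 0≤x = single G λ {I} _ → ℚ.≤-trans (⌜⌝-mono-≤ (∣p∣≤n I)) 0≤x

module _
  (β : ℝ) (k : ℕ) (β≤ratio : ¬ Below β (ratio k))
  (f : ℝ>0 → ℝ≥0) (f-mono : NonDecreasing f)
  (𝒢 : GraphClass ℓ) (hereditary : Hereditary 𝒢)
  (C : ℝ) {K : ℚ} (0<K : 0ℚ ℚ.< K) (C≤K : ¬ Below C K)
  (separate : ∀ {n} .{{_ : NonZero n}} (G : Graph n) → 𝒢 G →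
    ∃ λ 𝒮 → IsCliqueBasedSeparator G β 𝒮 × fromℕ (length 𝒮) ≤ C · f ⟨ n ⟩)
  where

  private
    0≤K = ℚ.<⇒≤ 0<K

    0≤f : ∀ n .{{_ : NonZero n}} → 0ℝ ≤ f ⟨ n ⟩
    0≤f n = ℝ≥0.nonnegative (f (fromℕ⁺ n))

    induced : (G : Graph n) → Member 𝒢 G → ∀ S → Induced 𝒢 G S
    induced = induce 𝒢 hereditary

    bounds-smaller : ∀ m n {r} → m ℕ.≤ n → r Bounds f at n → r Bounds f at m
    bounds-smaller m n m≤n r≥ f>r =
      r≥ {{≤-nonZero m≤n}} (f-mono (fromℕ⁺ m) (fromℕ⁺ n {{≤-nonZero m≤n}})
                              (fromℕ-mono-≤ m n m≤n) f>r)

  light⇒≤ : ∀ m n → fromℕ m ≤ β · fromℕ n → suc k ℕ.* m ℕ.≤ k ℕ.* n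
  light⇒≤ m n light = ⌜⌝-cancel-≤ (begin
    ⌜ suc k ℕ.* m ⌝                 ≡⟨ ⌜⌝-* (suc k) m ⟩
    ⌜ suc k ⌝ * ⌜ m ⌝               ≤⟨ *-monoˡ (0≤⌜⌝ (suc k))
      (≤·⇒≤* β (fromℕ n) (0≤fromℕ n) (0≤ratio k) β≤ratio (≤fromℕ n) light) ⟩
    ⌜ suc k ⌝ * (ratio k * ⌜ n ⌝)   ≡⟨ ℚ.*-assoc ⌜ suc k ⌝ (ratio k) ⌜ n ⌝ ⟨
    ⌜ suc k ⌝ * ratio k * ⌜ n ⌝     ≡⟨ cong (_* ⌜ n ⌝) (*-ratio k) ⟩
    ⌜ k ⌝ * ⌜ n ⌝                   ≡⟨ ⌜⌝-* k n ⟨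
    ⌜ k ℕ.* n ⌝                     ∎)
    where open ℚ.≤-Reasoning

  light⇒smaller : ∀ m n .{{_ : NonZero n}} → fromℕ m ≤ β · fromℕ n → m ℕ.< n
  light⇒smaller m n light = ℕ.*-cancelˡ-< (suc k) m n
    (ℕ.≤-<-trans (light⇒≤ m n light) (ℕ.*-monoˡ-< n (ℕ.n<1+n k)))

  split : .{{_ : NonZero n}} (G : Graph n) → 𝒢 G → ∀ {r} → ¬ Below (f ⟨ n ⟩) r →
          Split β 𝒢 G (K * r)
  split {n} G G∈𝒢 {r} f≤r = splitAt (separate G G∈𝒢)
    where
    splitAt : (∃ λ 𝒮 → IsCliqueBasedSeparator G β 𝒮 × fromℕ (length 𝒮) ≤ C · f ⟨ n ⟩) →
              Split β 𝒢 G (K * r)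
    splitAt (𝒮 , (cliques , _ , A , B , separation , balanced , ⋃≡∩) , size) = record
      { part₁  = part₁
      ; part₂  = part₂
      ; light₁ = light part₁ (ℕ.m≤m⊔n _ _)
      ; light₂ = light part₂ (ℕ.m≤n⊔m _ _)
      ; rejoin = λ {x} D₁ D₂ → relax (ℚ.+-monoˡ-≤ x ∣𝒮∣≤Kr)
          (glue cliques separation ⋃≡∩ part₁ part₂ D₁ D₂)
      }
      where
      part₁ = induced G G∈𝒢 (A ─ B)
      part₂ = induced G G∈𝒢 (B ─ A)
      ∣𝒮∣≤Kr : ⌜ length 𝒮 ⌝ ℚ.≤ K * r
      ∣𝒮∣≤Kr = ≤·⇒≤* C (f ⟨ n ⟩) (0≤f n) 0≤K C≤K f≤r size
      light : ∀ {S} (H : Induced 𝒢 G S) → ∣ S ∣ ℕ.≤ ∣ A ─ B ∣ ℕ.⊔ ∣ B ─ A ∣ →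
              fromℕ (Induced.order H) ≤ β · fromℕ n
      light H ∣S∣≤ {q} q< = balanced (fromℕ-mono-≤ (Induced.order H) (∣ A ─ B ∣ ℕ.⊔ ∣ B ─ A ∣)
        (ℕ.≤-trans (Induced.order≤∣S∣ H) ∣S∣≤) {q} q<)

  -- The invariant says n (k/(k+1))^j < 1. One level shrinks the size by k/(k+1) and uses up one
  -- `j`; at `j` = 0 no vertex is left. The same `r` serves at all levels because f is
  -- non-decreasing.
  decompose-levels : ∀ j (G : Graph n) → Member 𝒢 G → ∀ {r} → 0ℚ ℚ.≤ r → r Bounds f at n →
                     n ℕ.* k ℕ.^ j ℕ.< suc k ℕ.^ j → Decomposition G (⌜ j ⌝ * (K * r))
  decompose-levels {zero}  j       G _   0≤r _  _  =
    decompose-empty G (*-nonneg (0≤⌜⌝ j) (*-nonneg 0≤K 0≤r))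
  decompose-levels {suc n} zero    G _   0≤r _  (ℕ.s≤s ())
  decompose-levels {suc n} (suc j) G G∈𝒢 {r} 0≤r f≤r small =
    relax (ℚ.≤-reflexive (sym (⌜suc⌝* j (K * r)))) (rejoin (sub part₁ light₁) (sub part₂ light₂))
    where
    open Split (split G G∈𝒢 f≤r)
    sub : ∀ {S} (H : Induced 𝒢 G S) → fromℕ (Induced.order H) ≤ β · fromℕ (suc n) →
          Decomposition (Induced.graph H) (⌜ j ⌝ * (K * r))
    sub H light = decompose-levels j graph member 0≤r
      (bounds-smaller order (suc n) (ℕ.<⇒≤ (light⇒smaller order (suc n) light)) f≤r)
      (ℕ.*-cancelˡ-< (suc k) _ _ (begin-strict
        suc k ℕ.* (order ℕ.* k ℕ.^ j)    ≡⟨ ℕ.*-assoc (suc k) order (k ℕ.^ j) ⟨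
        suc k ℕ.* order ℕ.* k ℕ.^ j      ≤⟨ ℕ.*-monoˡ-≤ (k ℕ.^ j) (light⇒≤ order (suc n) light) ⟩
        k ℕ.* suc n ℕ.* k ℕ.^ j          ≡⟨ rearrange k (suc n) (k ℕ.^ j) ⟩
        suc n ℕ.* k ℕ.^ suc j            <⟨ small ⟩
        suc k ℕ.^ suc j                  ∎))
      where
      open Induced H
      open ℕ.≤-Reasoning
      rearrange : ∀ k n p → k ℕ.* n ℕ.* p ≡ n ℕ.* (k ℕ.* p)
      rearrange = solve-∀

  logarithmic-bound : .{{_ : NonZero k}} .{{_ : NonZero n}} (G : Graph n) → 𝒢 G → 2 ℕ.≤ n →
    ∀ t → IsTreeIndependenceNumber G t →
    fromℕ t ≤ fromℚ (⌜ k ℕ.+ k ⌝ * K) · (f ⟨ n ⟩ · log₂ n)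
  logarithmic-bound {n} G G∈𝒢 2≤n t tin = bound (dyadic n)
    where
    bound : (∃ λ e → 2 ℕ.^ e ℕ.≤ n × n ℕ.< 2 ℕ.^ suc e) →
            fromℕ t ≤ fromℚ (⌜ k ℕ.+ k ⌝ * K) · (f ⟨ n ⟩ · log₂ n)
    bound (zero      , _     , n<2)     = contradiction 2≤n (ℕ.<⇒≱ n<2)
    bound (e@(suc i) , 2^e≤n , n<2^1+e) =
      ≤fromℚ· (f ⟨ n ⟩ · log₂ n) (*-pos (0<⌜⌝ (k ℕ.+ k) {{≤-nonZero (ℕ.m≤m+n k k)}}) 0<K)
        (0≤· (f ⟨ n ⟩) (log₂ n) (0≤f n) 0≤log) t≤
      where
      e≤log : fromℕ e ≤ log₂ n
      e≤log = ≤log₂ {n} {e} 2^e≤n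
      0≤log : 0ℝ ≤ log₂ n
      0≤log q<0 = e≤log (0≤fromℕ e q<0)
      -- Rounding the logarithm costs one extra block of `k` levels. Since n ≥ 2 gives e ≥ 1, it is
      -- absorbed by doubling: hence the constant `k ℕ.+ k`.
      levels : k ℕ.* suc e ℕ.≤ (k ℕ.+ k) ℕ.* e
      levels = begin
        k ℕ.* (1 ℕ.+ e)       ≤⟨ ℕ.*-monoʳ-≤ k (ℕ.+-monoˡ-≤ e (ℕ.s≤s (ℕ.z≤n {i}))) ⟩
        k ℕ.* (e ℕ.+ e)       ≡⟨ ℕ.*-distribˡ-+ k e e ⟩
        k ℕ.* e ℕ.+ k ℕ.* e   ≡⟨ ℕ.*-distribʳ-+ e k k ⟨
        (k ℕ.+ k) ℕ.* e       ∎
        where open ℕ.≤-Reasoning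
      t≤ : ∀ r → ¬ Below (f ⟨ n ⟩ · log₂ n) r → ⌜ t ⌝ ℚ.≤ ⌜ k ℕ.+ k ⌝ * K * r
      t≤ r flog≤r = begin
        ⌜ t ⌝                                  ≤⟨ tree-independence≤ tin
          (decompose-levels (k ℕ.* suc e) G G∈𝒢 0≤s f≤s (n*k^j<[1+k]^j k (suc e) n<2^1+e)) ⟩
        ⌜ k ℕ.* suc e ⌝ * (K * s)              ≤⟨ *-monoʳ (*-nonneg 0≤K 0≤s) (⌜⌝-mono-≤ levels) ⟩
        ⌜ (k ℕ.+ k) ℕ.* e ⌝ * (K * s)          ≡⟨ cong (_* (K * s)) (⌜⌝-* (k ℕ.+ k) e) ⟩
        ⌜ k ℕ.+ k ⌝ * ⌜ e ⌝ * (K * s)          ≡⟨ *-interchange ⌜ k ℕ.+ k ⌝ ⌜ e ⌝ K s ⟩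
        ⌜ k ℕ.+ k ⌝ * K * (⌜ e ⌝ * s)          ≡⟨ cong (⌜ k ℕ.+ k ⌝ * K *_) (proj₂ r/e) ⟩
        ⌜ k ℕ.+ k ⌝ * K * r                    ∎
        where
        open ℚ.≤-Reasoning
        -- An upper bound `r` of f(n) log n yields the upper bound r/e of f(n), because e ≤ log n.
        r/e : ∃ λ s → ⌜ e ⌝ * s ≡ r
        r/e = divide r (0<⌜⌝ e)
        s = proj₁ r/e
        f≤s : ¬ Below (f ⟨ n ⟩) s
        f≤s f>s = flog≤r (·-comm (log₂ n) (f ⟨ n ⟩) (subst (Below (log₂ n · f ⟨ n ⟩)) (proj₂ r/e)
          (·-scale (log₂ n) (f ⟨ n ⟩) (0<⌜⌝ e) e≤log (0≤f n) f>s)))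
        0≤s : 0ℚ ℚ.≤ s
        0≤s = 0≤above {f ⟨ n ⟩} (0≤f n) f≤s

  module _ (c : ℝ) (l : ℕ) (c≤ratio : ¬ Below c (ratio l)) (contracts : Contracts β f c) where
    private N = proj₁ contracts

    -- A part may have fewer than ⌊βn⌋ vertices, so monotonicity first lifts f(m) to f(⌊βn⌋). A
    -- nonzero `m` makes the floor nonzero, and the conclusion is a negation, so a floor up to
    -- double negation is enough.
    contracted-bounds : ∀ m n .{{_ : NonZero n}} → N ℕ.≤ n → ∀ {r} → ¬ Below (f ⟨ n ⟩) r →
                        fromℕ m ≤ β · fromℕ n → (ratio l * r) Bounds f at m
    contracted-bounds m n N≤n {r} f≤r light fm>lr =
      ¬¬-floor (β · fromℕ n) n 0≤βn (λ {i} → ℕ.<⇒≤ ∘ light⇒smaller i n) λ (m′ , floor , max) →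
        let m≤m′ = max light
            instance m′≢0 = ≤-nonZero m≤m′
        in ·-above c (f ⟨ n ⟩) (0≤f n) (0≤ratio l) c≤ratio f≤r
             (proj₂ contracts n N≤n m′ floor
               (f-mono (fromℕ⁺ m) (fromℕ⁺ m′) (fromℕ-mono-≤ m m′ m≤m′) fm>lr))
      where
      0≤βn : 0ℝ ≤ β · fromℕ n
      0≤βn q<0 = light (ℚ.<-≤-trans q<0 (0≤⌜⌝ m))

    module _ (J : ℕ) (small : N ℕ.* k ℕ.^ J ℕ.< suc k ℕ.^ J) where
      -- Large enough both for the `J` levels of cost `K` that finish a graph with fewer than `N`
      -- vertices and for the single split of cost `K` above that threshold.
      private K′ = ⌜ suc J ⌝ * K

      -- The recursion is on `b`, a strict bound on the order, since the parts are not structurally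
      -- smaller. Each split passes `ratio l * r` down instead of `r`, which makes the costs
      -- geometric.
      decompose-contracting : ∀ b {n} → n ℕ.< b → (G : Graph n) → Member 𝒢 G →
        ∀ {r} → 0ℚ ℚ.≤ r → r Bounds f at n → Decomposition G (⌜ suc l ⌝ * (K′ * r))
      decompose-contracting (suc b) {zero} _ G _ 0≤r _ =
        decompose-empty G (*-nonneg (0≤⌜⌝ (suc l)) (*-nonneg (*-nonneg (0≤⌜⌝ (suc J)) 0≤K) 0≤r))
      decompose-contracting (suc b) {n@(suc _)} (ℕ.s≤s n≤b) G G∈𝒢 {r} 0≤r f≤r =
        step (N ℕ.≤? n)
        where
        sub : ∀ {S} (H : Induced 𝒢 G S) → N ℕ.≤ n →
              fromℕ (Induced.order H) ≤ β · fromℕ n →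
              Decomposition (Induced.graph H) (⌜ suc l ⌝ * (K′ * (ratio l * r)))
        sub H N≤n light =
          decompose-contracting b (ℕ.<-≤-trans (light⇒smaller order n light) n≤b) graph member
            (*-nonneg (0≤ratio l) 0≤r) (contracted-bounds order n N≤n f≤r light)
          where open Induced H

        step : Dec (N ℕ.≤ n) → Decomposition G (⌜ suc l ⌝ * (K′ * r))
        step (no N≰n) = relax (levels≤ l J 0≤K 0≤r)
          (decompose-levels J G G∈𝒢 0≤r f≤r
            (ℕ.≤-<-trans (ℕ.*-monoˡ-≤ (k ℕ.^ J) (ℕ.<⇒≤ (ℕ.≰⇒> N≰n))) small))
        step (yes N≤n) = relax (geometric-step l (≤⌜suc⌝* J 0≤K) 0≤r)
          (rejoin (sub part₁ N≤n light₁) (sub part₂ N≤n light₂))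
          where open Split (split G G∈𝒢 f≤r)

      linear-bound : .{{_ : NonZero n}} (G : Graph n) → 𝒢 G →
        ∀ t → IsTreeIndependenceNumber G t → fromℕ t ≤ fromℚ (⌜ suc l ⌝ * K′) · f ⟨ n ⟩
      linear-bound {n} G G∈𝒢 t tin =
        ≤fromℚ· (f ⟨ n ⟩) (*-pos (0<⌜⌝ (suc l)) (*-pos (0<⌜⌝ (suc J)) 0<K)) (0≤f n) λ r f≤r →
          subst (⌜ t ⌝ ℚ.≤_) (sym (ℚ.*-assoc ⌜ suc l ⌝ K′ r))
            (tree-independence≤ tin (decompose-contracting (suc n) (ℕ.n<1+n n) G G∈𝒢
              (0≤above {f ⟨ n ⟩} (0≤f n) f≤r) f≤r))

lemma1p1 : ∀ {ℓ} (β : ℝ) → 0ℝ < β → β < 1ℝ →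
    (f : ℝ>0 → ℝ≥0) → NonDecreasing f →
    (𝒢 : GraphClass ℓ) → Hereditary 𝒢 →
    (∃ λ (C : ℝ) → ∀ {n} .{{_ : NonZero n}} (G : Graph n) → 𝒢 G →
    ∃ λ 𝒮 → IsCliqueBasedSeparator G β 𝒮 × fromℕ (length 𝒮) ≤ C · f ⟨ n ⟩) →
    (∃ λ (C′ : ℝ) → ∀ {n} .{{_ : NonZero n}} (G : Graph n) → 𝒢 G → 2 ℕ.≤ n →
    ∀ k → IsTreeIndependenceNumber G k → fromℕ k ≤ C′ · (f ⟨ n ⟩ · log₂ n))
    ×
    ((∃ λ (ε : ℝ>0) → f IsΩ^ ε) →
    (∃ λ (c : ℝ) → c < 1ℝ × Contracts β f c) →
    ∃ λ (C′ : ℝ) → ∀ {n} .{{_ : NonZero n}} (G : Graph n) → 𝒢 G → 2 ℕ.≤ n →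
    ∀ k → IsTreeIndependenceNumber G k → fromℕ k ≤ C′ · f ⟨ n ⟩)
lemma1p1 β _ β<1 f f-mono 𝒢 hereditary (C , separate) =
  (fromℚ (⌜ k ℕ.+ k ⌝ * K) , logarithmic-bound β k β≤k f f-mono 𝒢 hereditary C 0<K C≤K separate) ,
  λ _ (c , c<1 , contracts) →
    let l , _ , c≤l = <1⇒ratio-above c c<1
        -- The successor supplies the nonzero argument of `dyadic`; k(e+1) levels then exhaust every
        -- graph with at most N vertices.
        e , _ , N<  = dyadic (suc (proj₁ contracts))
        small       = n*k^j<[1+k]^j k (suc e) (ℕ.<-trans (ℕ.n<1+n (proj₁ contracts)) N<)
    in fromℚ (⌜ suc l ⌝ * (⌜ suc (k ℕ.* suc e) ⌝ * K)) , λ G G∈𝒢 _ →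
         linear-bound β k β≤k f f-mono 𝒢 hereditary C 0<K C≤K separate
             c l c≤l contracts (k ℕ.* suc e) small G G∈𝒢
  where
  ratio-above = <1⇒ratio-above β β<1
  k   = proj₁ ratio-above
  instance
    k≢0 : NonZero k
    k≢0 = proj₁ (proj₂ ratio-above)
  β≤k = proj₂ (proj₂ ratio-above)
  q   = proj₁ (ℝ.bounded C)
  -- The maximum with 1 makes `K` positive, whatever the sign of `C`.
  K   = q ℚ.⊔ 1ℚ
  0<K : 0ℚ ℚ.< K
  0<K = ℚ.<-≤-trans (ℚ.positive⁻¹ 1ℚ) (ℚ.p≤q⊔p q 1ℚ)
  C≤K : ¬ Below C K
  C≤K C>K = proj₂ (ℝ.bounded C) (ℝ.downward C (ℚ.p≤p⊔q q 1ℚ) C>K)
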